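{- For every $n\in\mathbb{N}$, $n\ge 1$, the polynomial $$A_n(\mathbf{x},\mathbf{1})=\sum_{\sigma\in\mathfrak{S}_{n+1}}\ \prod_{i\in\mathcal{DT}(\sigma)}x_i$$ is a real zero polynomial.
   Context: Permutations $\sigma\in\mathfrak{S}_{n+1}$ of $[n+1]=\{1,\dots,n+1\}$ are written in one-line notation $\sigma_1\cdots\sigma_{n+1}$. The descent top set is $\mathcal{DT}(\sigma)=\{\sigma_i\mid i\in[n],\ \sigma_i>\sigma_{i+1}\}$ and the ascent top set is $\mathcal{AT}(\sigma)=\{\sigma_{i+1}\mid i\in[n],\ \sigma_i<\sigma_{i+1}\}$; both are contained in $\{2,\dots,n+1\}$. The descents-ascents Eulerian polynomial is $A_n(\mathbf{x},\mathbf{y})=\sum_{\sigma\in\mathfrak{S}_{n+1}}\prod_{i\in\mathcal{DT}(\sigma)}x_i\prod_{j\in\mathcal{AT}(\sigma)}y_j$, and $A_n(\mathbf{x},\mathbf{1})$ is obtained from it by setting all the $y_j$ equal to $1$. A polynomial $p\in\mathbb{R}[x_1,\dots,x_m]$ is a real zero (RZ) polynomial if for all $a\in\mathbb{R}^m$ and all $\lambda\in\mathbb{C}$, $p(\lambda a)=0$ implies $\lambda\in\mathbb{R}$. -}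

module Defs where

open import Algebra.Bundles using (CommutativeMonoid)
open import Algebra.Bundles.Raw using (RawRing)
import Algebra.Definitions.RawSemiring as RawSemiringDefs
import Algebra.Properties.CommutativeSemigroup as CommutativeSemigroupProperties
import Algebra.Properties.Ring as RingProperties
open import Data.Bool.Base using (if_then_else_)
open import Data.Fin.Base as Fin using (Fin; zero; suc; inject₁)
import Data.Fin.Properties as Fin
open import Data.List.Base as List using (List; []; _∷_; allFin; cartesianProductWith; filter)
import Data.List.Properties as List
open import Data.Nat.Base as ℕ using (ℕ; zero; suc)
import Data.Nat.Properties as ℕ
open import Data.Product.Base using (_×_; _,_; proj₁; ∃-syntax; map₂)
open import Data.Rational.Base as ℚ using (ℚ; 0ℚ; 1ℚ; ½)
import Data.Rational.Properties as ℚ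
open import Data.Vec.Base as Vec using (Vec; []; _∷_; lookup; tabulate)
import Data.Vec.Properties as Vec
open import Data.Vec.Functional using (Vector)
open import Data.Vec.Relation.Unary.AllPairs using (allPairs?)
open import Data.Vec.Relation.Unary.Unique.Propositional using (Unique)
open import Level using (0ℓ)
open import Relation.Binary.PropositionalEquality
  using (_≡_; refl; sym; trans; cong; cong₂; subst)
open import Relation.Nullary.Decidable using (Dec; does; ¬?; _×-dec_)
open import Relation.Nullary.Negation using (¬_)

------------------------------------------------------------------------
-- Real numbers, as Cauchy sequences of rationals.
--
-- The existential in IsCauchy is a Σ-type, so a real carries a modulus
-- of convergence. Equality of reals is _≃_.

IsCauchy : (ℕ → ℚ) → Set
IsCauchy s = ∀ ε → 0ℚ ℚ.< ε →
  ∃[ N ] (∀ m n → N ℕ.≤ m → N ℕ.≤ n → ℚ.∣ s m ℚ.- s n ∣ ℚ.< ε)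

record ℝ : Set where
  constructor mkℝ
  field
    seq    : ℕ → ℚ
    cauchy : IsCauchy seq

open ℝ public

infix 4 _≃_

_≃_ : ℝ → ℝ → Set
x ≃ y = ∀ ε → 0ℚ ℚ.< ε →
  ∃[ N ] (∀ n → N ℕ.≤ n → ℚ.∣ seq x n ℚ.- seq y n ∣ ℚ.< ε)

open RingProperties ℚ.+-*-ring using (-‿+-comm; x[y-z]≈xy-xz; xyx⁻¹≈y)
open CommutativeSemigroupProperties
  (CommutativeMonoid.commutativeSemigroup ℚ.+-0-commutativeMonoid) using (interchange)

half-pos : ∀ {ε} → 0ℚ ℚ.< ε → 0ℚ ℚ.< ½ ℚ.* ε
half-pos {ε} 0<ε = subst (ℚ._< ½ ℚ.* ε) (ℚ.*-zeroʳ ½) (ℚ.*-monoʳ-<-pos ½ 0<ε)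

halves : ∀ ε → ½ ℚ.* ε ℚ.+ ½ ℚ.* ε ≡ ε
halves ε = trans (sym (ℚ.*-distribʳ-+ ε ½ ½)) (ℚ.*-identityˡ ε)

const-cauchy : ∀ q → IsCauchy (λ _ → q)
const-cauchy q ε 0<ε = 0 , λ _ _ _ _ →
  subst (ℚ._< ε) (cong ℚ.∣_∣ (sym (ℚ.+-inverseʳ q))) 0<ε

+-cauchy : ∀ {s t} → IsCauchy s → IsCauchy t → IsCauchy (λ n → s n ℚ.+ t n)
+-cauchy {s} {t} cs ct ε 0<ε
  with M , hs ← cs (½ ℚ.* ε) (half-pos 0<ε)
     | N , ht ← ct (½ ℚ.* ε) (half-pos 0<ε)
  = M ℕ.⊔ N , λ m n m≥ n≥ → begin-strict
      ℚ.∣ s m ℚ.+ t m ℚ.- (s n ℚ.+ t n) ∣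
        ≡⟨ cong ℚ.∣_∣ (rearrange (s m) (t m) (s n) (t n)) ⟩
      ℚ.∣ (s m ℚ.- s n) ℚ.+ (t m ℚ.- t n) ∣
        ≤⟨ ℚ.∣p+q∣≤∣p∣+∣q∣ (s m ℚ.- s n) (t m ℚ.- t n) ⟩
      ℚ.∣ s m ℚ.- s n ∣ ℚ.+ ℚ.∣ t m ℚ.- t n ∣
        <⟨ ℚ.+-mono-< (hs m n (ℕ.m⊔n≤o⇒m≤o M N m≥) (ℕ.m⊔n≤o⇒m≤o M N n≥))
                      (ht m n (ℕ.m⊔n≤o⇒n≤o M N m≥) (ℕ.m⊔n≤o⇒n≤o M N n≥)) ⟩
      ½ ℚ.* ε ℚ.+ ½ ℚ.* ε
        ≡⟨ halves ε ⟩
      ε ∎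
  where
  open ℚ.≤-Reasoning
  rearrange : ∀ a b c d → a ℚ.+ b ℚ.- (c ℚ.+ d) ≡ (a ℚ.- c) ℚ.+ (b ℚ.- d)
  rearrange a b c d = trans (cong (a ℚ.+ b ℚ.+_) (sym (-‿+-comm c d)))
                            (interchange a b (ℚ.- c) (ℚ.- d))

neg-cauchy : ∀ {s} → IsCauchy s → IsCauchy (λ n → ℚ.- s n)
neg-cauchy {s} cs ε 0<ε = map₂
  (λ h m n m≥ n≥ → subst (ℚ._< ε) (eq (s m) (s n)) (h m n m≥ n≥))
  (cs ε 0<ε)
  where
  eq : ∀ a b → ℚ.∣ a ℚ.- b ∣ ≡ ℚ.∣ ℚ.- a ℚ.- ℚ.- b ∣
  eq a b = trans (sym (ℚ.∣-p∣≡∣p∣ (a ℚ.- b)))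
    (cong ℚ.∣_∣ (sym (-‿+-comm a (ℚ.- b))))

0<1 : 0ℚ ℚ.< 1ℚ
0<1 = ℚ.positive⁻¹ 1ℚ

bounded : ∀ {s} → IsCauchy s →
  ∃[ B ] (0ℚ ℚ.< B × ∃[ N ] (∀ n → N ℕ.≤ n → ℚ.∣ s n ∣ ℚ.≤ B))
bounded {s} cs with N , h ← cs 1ℚ 0<1
  = ℚ.∣ s N ∣ ℚ.+ 1ℚ
  , ℚ.+-mono-≤-< (ℚ.0≤∣p∣ (s N)) 0<1
  , N , λ n n≥ → begin
      ℚ.∣ s n ∣
        ≡⟨ cong ℚ.∣_∣ (rearrange (s n) (s N)) ⟩
      ℚ.∣ s N ℚ.+ (s n ℚ.- s N) ∣
        ≤⟨ ℚ.∣p+q∣≤∣p∣+∣q∣ (s N) (s n ℚ.- s N) ⟩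
      ℚ.∣ s N ∣ ℚ.+ ℚ.∣ s n ℚ.- s N ∣
        ≤⟨ ℚ.+-monoʳ-≤ ℚ.∣ s N ∣ (ℚ.<⇒≤ (h n N n≥ ℕ.≤-refl)) ⟩
      ℚ.∣ s N ∣ ℚ.+ 1ℚ ∎
  where
  open ℚ.≤-Reasoning
  rearrange : ∀ a b → a ≡ b ℚ.+ (a ℚ.- b)
  rearrange a b = sym (trans (sym (ℚ.+-assoc b a (ℚ.- b))) (xyx⁻¹≈y b a))

*-cauchy : ∀ {s t} → IsCauchy s → IsCauchy t → IsCauchy (λ n → s n ℚ.* t n)
*-cauchy {s} {t} cs ct ε 0<ε
  with S , 0<S , M₀ , bs ← bounded cs
     | T , 0<T , N₀ , bt ← bounded ct
  = body
  where
  open ℚ.≤-Reasoning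
  K : ℚ
  K = S ℚ.+ T
  instance
    posS : ℚ.Positive S
    posS = ℚ.positive 0<S
    posT : ℚ.Positive T
    posT = ℚ.positive 0<T
    posK : ℚ.Positive K
    posK = ℚ.pos+pos⇒pos S T
    nzK : ℚ.NonZero K
    nzK = ℚ.pos⇒nonZero K
    posK⁻¹ : ℚ.Positive (ℚ.1/ K)
    posK⁻¹ = ℚ.1/pos⇒pos K
    nnT : ℚ.NonNegative T
    nnT = ℚ.pos⇒nonNeg T
  δ : ℚ
  δ = ℚ.1/ K ℚ.* ε
  0<δ : 0ℚ ℚ.< δ
  0<δ = subst (ℚ._< δ) (ℚ.*-zeroʳ (ℚ.1/ K)) (ℚ.*-monoʳ-<-pos (ℚ.1/ K) 0<ε)
  Kδ≡ε : K ℚ.* δ ≡ ε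
  Kδ≡ε = trans (sym (ℚ.*-assoc K (ℚ.1/ K) ε))
               (trans (cong (ℚ._* ε) (ℚ.*-inverseʳ K)) (ℚ.*-identityˡ ε))
  telescope : ∀ x y z → (x ℚ.- y) ℚ.+ (y ℚ.- z) ≡ x ℚ.- z
  telescope x y z = trans (ℚ.+-assoc x (ℚ.- y) (y ℚ.- z)) (cong (x ℚ.+_)
    (trans (sym (ℚ.+-assoc (ℚ.- y) y (ℚ.- z)))
      (trans (cong (ℚ._- z) (ℚ.+-inverseˡ y)) (ℚ.+-identityˡ (ℚ.- z)))))
  rearrange : ∀ a b c d → a ℚ.* b ℚ.- c ℚ.* d ≡ a ℚ.* (b ℚ.- d) ℚ.+ d ℚ.* (a ℚ.- c)
  rearrange a b c d = sym (trans
    (cong₂ ℚ._+_ (x[y-z]≈xy-xz a b d)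
      (trans (x[y-z]≈xy-xz d a c)
        (cong₂ ℚ._-_ (ℚ.*-comm d a) (ℚ.*-comm d c))))
    (telescope (a ℚ.* b) (a ℚ.* d) (c ℚ.* d)))
  scaled : ∀ {B} a d → .{{ℚ.Positive B}} → ℚ.∣ a ∣ ℚ.≤ B → ℚ.∣ d ∣ ℚ.< δ →
           ℚ.∣ a ℚ.* d ∣ ℚ.< B ℚ.* δ
  scaled {B} a d a≤B d<δ = begin-strict
    ℚ.∣ a ℚ.* d ∣        ≡⟨ ℚ.∣p*q∣≡∣p∣*∣q∣ a d ⟩
    ℚ.∣ a ∣ ℚ.* ℚ.∣ d ∣  ≤⟨ ℚ.*-monoʳ-≤-nonNeg ℚ.∣ d ∣ {{ℚ.∣-∣-nonNeg d}} a≤B ⟩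
    B ℚ.* ℚ.∣ d ∣        <⟨ ℚ.*-monoʳ-<-pos B d<δ ⟩
    B ℚ.* δ ∎
  body : ∃[ N ] (∀ m n → N ℕ.≤ m → N ℕ.≤ n →
           ℚ.∣ s m ℚ.* t m ℚ.- s n ℚ.* t n ∣ ℚ.< ε)
  body with M , hs ← cs δ 0<δ | N , ht ← ct δ 0<δ
    = (M₀ ℕ.⊔ N₀) ℕ.⊔ (M ℕ.⊔ N) , λ m n m≥ n≥ →
      let m≥₀ = ℕ.m⊔n≤o⇒m≤o (M₀ ℕ.⊔ N₀) (M ℕ.⊔ N) m≥
          n≥₀ = ℕ.m⊔n≤o⇒m≤o (M₀ ℕ.⊔ N₀) (M ℕ.⊔ N) n≥
          m≥₁ = ℕ.m⊔n≤o⇒n≤o (M₀ ℕ.⊔ N₀) (M ℕ.⊔ N) m≥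
          n≥₁ = ℕ.m⊔n≤o⇒n≤o (M₀ ℕ.⊔ N₀) (M ℕ.⊔ N) n≥
      in begin-strict
        ℚ.∣ s m ℚ.* t m ℚ.- s n ℚ.* t n ∣
          ≡⟨ cong ℚ.∣_∣ (rearrange (s m) (t m) (s n) (t n)) ⟩
        ℚ.∣ s m ℚ.* (t m ℚ.- t n) ℚ.+ t n ℚ.* (s m ℚ.- s n) ∣
          ≤⟨ ℚ.∣p+q∣≤∣p∣+∣q∣ (s m ℚ.* (t m ℚ.- t n)) (t n ℚ.* (s m ℚ.- s n)) ⟩
        ℚ.∣ s m ℚ.* (t m ℚ.- t n) ∣ ℚ.+ ℚ.∣ t n ℚ.* (s m ℚ.- s n) ∣
          <⟨ ℚ.+-mono-<
               (scaled (s m) (t m ℚ.- t n) (bs m (ℕ.m⊔n≤o⇒m≤o M₀ N₀ m≥₀))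
                 (ht m n (ℕ.m⊔n≤o⇒n≤o M N m≥₁) (ℕ.m⊔n≤o⇒n≤o M N n≥₁)))
               (scaled (t n) (s m ℚ.- s n) (bt n (ℕ.m⊔n≤o⇒n≤o M₀ N₀ n≥₀))
                 (hs m n (ℕ.m⊔n≤o⇒m≤o M N m≥₁) (ℕ.m⊔n≤o⇒m≤o M N n≥₁))) ⟩
        S ℚ.* δ ℚ.+ T ℚ.* δ
          ≡⟨ sym (ℚ.*-distribʳ-+ δ S T) ⟩
        K ℚ.* δ
          ≡⟨ Kδ≡ε ⟩
        ε ∎

fromℚ : ℚ → ℝ
fromℚ q = mkℝ (λ _ → q) (const-cauchy q)

0ℝ 1ℝ : ℝ
0ℝ = fromℚ 0ℚ
1ℝ = fromℚ 1ℚ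

infixl 6 _+ℝ_
infixl 7 _*ℝ_
infix  8 -ℝ_

_+ℝ_ _*ℝ_ : ℝ → ℝ → ℝ
x +ℝ y = mkℝ (λ n → seq x n ℚ.+ seq y n) (+-cauchy {seq x} {seq y} (cauchy x) (cauchy y))
x *ℝ y = mkℝ (λ n → seq x n ℚ.* seq y n) (*-cauchy {seq x} {seq y} (cauchy x) (cauchy y))

-ℝ_ : ℝ → ℝ
-ℝ x = mkℝ (λ n → ℚ.- seq x n) (neg-cauchy {seq x} (cauchy x))

record ℂ : Set where
  constructor _+i_
  field
    Re Im : ℝ

open ℂ public

infix 4 _≃ℂ_

_≃ℂ_ : ℂ → ℂ → Set
w ≃ℂ z = (Re w ≃ Re z) × (Im w ≃ Im z)

ofReal : ℝ → ℂ
ofReal r = r +i 0ℝ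

IsReal : ℂ → Set
IsReal z = ∃[ r ] (z ≃ℂ ofReal r)

infixl 6 _+ℂ_
infixl 7 _*ℂ_

_+ℂ_ _*ℂ_ : ℂ → ℂ → ℂ
w +ℂ z = (Re w +ℝ Re z) +i (Im w +ℝ Im z)
w *ℂ z = (Re w *ℝ Re z +ℝ -ℝ (Im w *ℝ Im z)) +i (Re w *ℝ Im z +ℝ Im w *ℝ Re z)

ℂ-rawRing : RawRing 0ℓ 0ℓ
ℂ-rawRing = record
  { Carrier = ℂ
  ; _≈_     = _≃ℂ_
  ; _+_     = _+ℂ_
  ; _*_     = _*ℂ_
  ; -_      = λ z → (-ℝ Re z) +i (-ℝ Im z)
  ; 0#      = ofReal 0ℝ
  ; 1#      = ofReal 1ℝ
  }

------------------------------------------------------------------------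
-- Polynomials over ℝ in m variables, as finite formal sums of terms
-- (coefficient , exponent vector). Like terms need not be collected.

Polynomial : ℕ → Set
Polynomial m = List (ℝ × Vec ℕ m)

module _ where
  open RawRing ℂ-rawRing
  open RawSemiringDefs rawSemiring using (product; _^_)

  evalTerm : ∀ {m} → ℝ × Vec ℕ m → Vector ℂ m → ℂ
  evalTerm (c , e) z = ofReal c * product (λ i → z i ^ lookup e i)

  eval : ∀ {m} → Polynomial m → Vector ℂ m → ℂ
  eval p z = List.foldr (λ t acc → evalTerm t z + acc) 0# p

  IsRealZero : ∀ {m} → Polynomial m → Set
  IsRealZero {m} p = (a : Vector ℝ m) (z : ℂ) →
    eval p (λ i → z * ofReal (a i)) ≈ 0# → IsReal z

-- Setting a variable to 1 erases its exponent from every term.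
setLastTo1 : ∀ {m k} → Polynomial (m ℕ.+ k) → Polynomial m
setLastTo1 {m} = List.map (map₂ (Vec.take m))

------------------------------------------------------------------------
-- Permutations in one-line notation. Letters and positions are counted
-- from 0: the value v ∈ {1,…,n+1} is the element v ∸ 1 of Fin (suc n).

words : ∀ k m → List (Vec (Fin k) m)
words k zero    = [] ∷ []
words k (suc m) = cartesianProductWith _∷_ (allFin k) (words k m)

𝔖 : ∀ k → List (Vec (Fin k) k)
𝔖 k = filter {P = Unique} (allPairs? (λ u v → ¬? (u Fin.≟ v))) (words k k)

-- k ∈ 𝒟𝒯(σ)
DescentTop : ∀ {n} → Vec (Fin (suc n)) (suc n) → Fin (suc n) → Set
DescentTop {n} σ k = ∃[ i ]
  (lookup σ (inject₁ i) Fin.> lookup σ (suc i) × k ≡ lookup σ (inject₁ i))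

-- k ∈ 𝒜𝒯(σ)
AscentTop : ∀ {n} → Vec (Fin (suc n)) (suc n) → Fin (suc n) → Set
AscentTop {n} σ k = ∃[ i ]
  (lookup σ (inject₁ i) Fin.< lookup σ (suc i) × k ≡ lookup σ (suc i))

descentTop? : ∀ {n} (σ : Vec (Fin (suc n)) (suc n)) k → Dec (DescentTop σ k)
descentTop? σ k = Fin.any? λ i →
  (lookup σ (suc i) Fin.<? lookup σ (inject₁ i)) ×-dec (k Fin.≟ lookup σ (inject₁ i))

ascentTop? : ∀ {n} (σ : Vec (Fin (suc n)) (suc n)) k → Dec (AscentTop σ k)
ascentTop? σ k = Fin.any? λ i →
  (lookup σ (inject₁ i) Fin.<? lookup σ (suc i)) ×-dec (k Fin.≟ lookup σ (suc i))

-- The smallest letter is never a top, so n variables x₂,…,xₙ₊₁ (and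
-- likewise y₂,…,yₙ₊₁) suffice; the variable with index i : Fin n belongs
-- to the letter suc i.

¬descentTop-zero : ∀ {n} (σ : Vec (Fin (suc n)) (suc n)) → ¬ DescentTop σ zero
¬descentTop-zero σ (i , gt , eq) with lookup σ (inject₁ i)
¬descentTop-zero σ (i , () , refl) | .zero

¬ascentTop-zero : ∀ {n} (σ : Vec (Fin (suc n)) (suc n)) → ¬ AscentTop σ zero
¬ascentTop-zero σ (i , lt , eq) with lookup σ (suc i)
¬ascentTop-zero σ (i , () , refl) | .zero

descentTopMonomial ascentTopMonomial : ∀ {n} → Vec (Fin (suc n)) (suc n) → Vec ℕ n
descentTopMonomial σ = tabulate λ i → if does (descentTop? σ (suc i)) then 1 else 0
ascentTopMonomial  σ = tabulate λ i → if does (ascentTop? σ (suc i)) then 1 else 0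

-- Aₙ(𝐱,𝐲); the first n variables are 𝐱, the last n are 𝐲.
A : ∀ n → Polynomial (n ℕ.+ n)
A n = List.map (λ σ → 1ℝ , descentTopMonomial σ Vec.++ ascentTopMonomial σ) (𝔖 (suc n))

A[𝐱,𝟏] : ∀ n → Polynomial n
A[𝐱,𝟏] n = setLastTo1 {n} {n} (A n)

A[𝐱,𝟏]-expand : ∀ n →
  A[𝐱,𝟏] n ≡ List.map (λ σ → 1ℝ , descentTopMonomial σ) (𝔖 (suc n))
A[𝐱,𝟏]-expand n = trans (sym (List.map-∘ (𝔖 (suc n))))
  (List.map-cong
    (λ σ → cong (1ℝ ,_)
      (proj₁ (Vec.++-injective (Vec.take n (descentTopMonomial σ Vec.++ ascentTopMonomial σ))
        (descentTopMonomial σ)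
        (Vec.take++drop≡id n (descentTopMonomial σ Vec.++ ascentTopMonomial σ)))))
    (𝔖 (suc n)))

{-# OPTIONS --safe #-}

-- Inserting the largest letter k into the permutations of the smaller ones replaces the
-- generating polynomial p of descent tops (xᵢ) and ascent tops (yᵢ) by
-- (xₖ + yₖ) p + xₖ yₖ D p, where D is the sum of all partial derivatives. This operation
-- preserves the absence of zeros with Im (c xᵢ) ≥ 0 and Im (c yᵢ) > 0, for any fixed complex c:
-- as p is affine in each variable v, nonvanishing forces Im (c p · conj (∂p/∂v)) ≥ 0, hence
-- Im (c p · conj (D p)) ≥ 0, and this inequality excludes zeros of (x + y) p + x y D p.
-- If Im z ≠ 0, take c = ± conj z with Im c > 0, xᵢ = z aᵢ and yᵢ = 1.
--
-- Both the non-strict inequalities and the conclusion Im z ≃ 0 are negative statements about the reals,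
-- so that a classical argument is available constructively.

module Submission where

open import Algebra.Bundles using (CommutativeMonoid; CommutativeRing; CommutativeSemiring)
open import Algebra.Bundles.Raw using (RawRing)
import Algebra.Definitions.RawSemiring as RawSemiringDefs
import Algebra.Properties.CommutativeSemigroup as CommutativeSemigroupProperties
import Algebra.Properties.Monoid.Mult as MonoidMult
import Algebra.Properties.Ring as RingProperties
import Algebra.Solver.Ring.NaturalCoefficients.Default as SemiringSolver
open import Algebra.Structures using (IsCommutativeRing)
open import Algebra.Structures.Biased using (IsCommutativeSemiringˡ)
open import Data.Bool.Base as Bool using (true; false; if_then_else_)
open import Data.Fin.Base as Fin using (Fin; zero; suc; toℕ; fromℕ<; inject₁)
import Data.Fin.Properties as Fin
import Data.Integer.Base as ℤ
open import Data.List.Base as List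
  using (List; []; _∷_; _++_; concatMap; downFrom; filter; length; map)
open import Data.List.Membership.Propositional using (_∈_)
import Data.List.Membership.Propositional.Properties as ∈
open import Data.List.Membership.Propositional.Properties.WithK using (unique∧set⇒bag)
import Data.List.Properties as List
open import Data.List.Relation.Binary.BagAndSetEquality using (∼bag⇒↭)
open import Data.List.Relation.Binary.Permutation.Propositional as ↭
  using (_↭_; ↭-refl; ↭-sym; ↭-trans)
import Data.List.Relation.Binary.Permutation.Propositional.Properties as ↭P
open import Data.List.Relation.Unary.All as All using (All; []; _∷_)
import Data.List.Relation.Unary.All.Properties as All
open import Data.List.Relation.Unary.AllPairs using ([]; _∷_)
open import Data.List.Relation.Unary.Any as Any using (here; there)
open import Data.List.Relation.Unary.Unique.Propositional using (Unique)
import Data.List.Relation.Unary.Unique.Propositional.Properties as Unique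
open import Data.Nat.Base as ℕ using (ℕ; zero; suc; _⊔_; _<_; _<ᵇ_; _≥_)
import Data.Nat.Properties as ℕ
open import Data.Product.Base using (_×_; _,_; proj₁; proj₂; ∃-syntax; map₂)
open import Data.Rational.Base as ℚ using (ℚ; 0ℚ; 1ℚ; ½; ∣_∣)
import Data.Rational.Properties as ℚ
open import Data.Rational.Solver using (module +-*-Solver)
open import Data.Sum.Base using (_⊎_; inj₁; inj₂; [_,_]′)
open import Data.Unit.Base using (⊤; tt)
open import Data.Vec.Base as Vec using (Vec; []; _∷_; lookup)
open import Data.Vec.Functional using (Vector)
import Data.Vec.Properties as Vec
open import Data.Vec.Relation.Unary.All as VecAll using ([]; _∷_)
open import Data.Vec.Relation.Unary.AllPairs as VecAllPairs using ([]; _∷_)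
import Data.Vec.Relation.Unary.Unique.Propositional as Vec
open import Function.Base using (_∘_)
open import Function.Bundles using (mk⇔)
open import Level using (0ℓ)
import Relation.Binary.PropositionalEquality as ≡
open ≡ using (_≡_; _≢_)
import Relation.Binary.Reasoning.Setoid as SetoidReasoning
open import Relation.Binary.Structures using (IsEquivalence)
open import Relation.Nullary.Decidable using (Dec; does; yes; no; ¬?)
open import Relation.Nullary.Negation using (¬_; contradiction)
open import Relation.Unary using (Decidable)

open import Defs

-- The polynomial is needed in two forms that do not fit together. Locating zeros calls for a
-- multiaffine polynomial given by its two coefficients in each variable; the insertion argument
-- calls for a sum over words, whose weights are products with one factor per adjacent pair. Both
-- are restricted to the diagonal line through a point, on which every variable is increased by the
-- same parameter s. There `D` becomes the derivative in s, a derivation taking each variable to 1,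
-- and this is all that insertion uses. Words are therefore weighed by series in s, and the weight
-- of a word never has to be written as a `Poly`.
--
-- The ascent variables stay independent until the very end, although they are finally set to 1,
-- because the recursion differentiates in them as well. They also supply the only strict
-- inequality: `c * x` is real at the points of interest, and `x` itself may be zero there.
--
-- Multiaffinity makes the contradiction explicit: the single possible zero in one variable can be
-- written down, and it only has to be located in the domain.

-- Cauchy reals: equality through null sequences, and strict positivity

module ℝ-Properties where
  open ≡ using (refl; sym; trans; cong; subst)
  open +-*-Solver using (solve; _:=_; _:+_; _:*_; _:-_; :-_; con)

  Null : (ℕ → ℚ) → Set
  Null s = ∀ ε → 0ℚ ℚ.< ε → ∃[ N ] (∀ n → N ℕ.≤ n → ∣ s n ∣ ℚ.< ε)

  null-cong : ∀ {s t} → (∀ n → s n ≡ t n) → Null s → Null t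
  null-cong s≗t sN ε 0<ε = map₂ (λ h n N≤n → subst (λ q → ∣ q ∣ ℚ.< ε) (s≗t n) (h n N≤n)) (sN ε 0<ε)

  null-0 : ∀ {s} → (∀ n → s n ≡ 0ℚ) → Null s
  null-0 s≗0 ε 0<ε = 0 , λ n _ → subst (λ q → ∣ q ∣ ℚ.< ε) (sym (s≗0 n)) 0<ε

  null-+ : ∀ {s t} → Null s → Null t → Null (λ n → s n ℚ.+ t n)
  null-+ {s} {t} sN tN ε 0<ε
    with M , hs ← sN (½ ℚ.* ε) (half-pos 0<ε)
       | N , ht ← tN (½ ℚ.* ε) (half-pos 0<ε)
    = M ⊔ N , λ n h → subst (∣ s n ℚ.+ t n ∣ ℚ.<_) (halves ε)
        (ℚ.≤-<-trans (ℚ.∣p+q∣≤∣p∣+∣q∣ (s n) (t n))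
          (ℚ.+-mono-< (hs n (ℕ.m⊔n≤o⇒m≤o M N h)) (ht n (ℕ.m⊔n≤o⇒n≤o M N h))))

  null-neg : ∀ {s} → Null s → Null (λ n → ℚ.- s n)
  null-neg {s} sN ε 0<ε =
    map₂ (λ h n N≤n → subst (ℚ._< ε) (sym (ℚ.∣-p∣≡∣p∣ (s n))) (h n N≤n)) (sN ε 0<ε)

  null-*-bounded : ∀ {s t : ℕ → ℚ} B → 0ℚ ℚ.< B → ∃[ M ] (∀ n → M ℕ.≤ n → ∣ s n ∣ ℚ.≤ B) →
                   Null t → Null (λ n → s n ℚ.* t n)
  null-*-bounded {s} {t} B 0<B (M , hs) tN ε 0<ε =
    let N , ht = tN δ 0<δ in M ⊔ N , λ n h → begin-strict
      ∣ s n ℚ.* t n ∣      ≡⟨ ℚ.∣p*q∣≡∣p∣*∣q∣ (s n) (t n) ⟩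
      ∣ s n ∣ ℚ.* ∣ t n ∣  ≤⟨ ℚ.*-monoʳ-≤-nonNeg ∣ t n ∣ {{ℚ.∣-∣-nonNeg (t n)}} (hs n (ℕ.m⊔n≤o⇒m≤o M N h)) ⟩
      B ℚ.* ∣ t n ∣        <⟨ ℚ.*-monoʳ-<-pos B (ht n (ℕ.m⊔n≤o⇒n≤o M N h)) ⟩
      B ℚ.* δ              ≡⟨ Bδ≡ε ⟩
      ε                    ∎
    where
    open ℚ.≤-Reasoning
    instance
      posB : ℚ.Positive B
      posB = ℚ.positive 0<B
      nzB : ℚ.NonZero B
      nzB = ℚ.pos⇒nonZero B
      pos1/B : ℚ.Positive (ℚ.1/ B)
      pos1/B = ℚ.1/pos⇒pos B
    δ : ℚ
    δ = ℚ.1/ B ℚ.* ε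
    0<δ : 0ℚ ℚ.< δ
    0<δ = subst (ℚ._< δ) (ℚ.*-zeroʳ (ℚ.1/ B)) (ℚ.*-monoʳ-<-pos (ℚ.1/ B) 0<ε)
    Bδ≡ε : B ℚ.* δ ≡ ε
    Bδ≡ε = trans (sym (ℚ.*-assoc B (ℚ.1/ B) ε))
                 (trans (cong (ℚ._* ε) (ℚ.*-inverseʳ B)) (ℚ.*-identityˡ ε))

  null-* : ∀ {s t} → IsCauchy s → Null t → Null (λ n → s n ℚ.* t n)
  null-* {s} {t} cs = let B , 0<B , hs = bounded {s} cs in null-*-bounded {s} {t} B 0<B hs

  ≃-pointwise : ∀ x y → (∀ n → seq x n ≡ seq y n) → x ≃ y
  ≃-pointwise x y x≗y = null-0 λ n →
    trans (cong (ℚ._- seq y n) (x≗y n)) (ℚ.+-inverseʳ (seq y n))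

  ≃-refl : ∀ x → x ≃ x
  ≃-refl x = ≃-pointwise x x λ _ → refl

  ≃-sym : ∀ x y → x ≃ y → y ≃ x
  ≃-sym x y x≃y = null-cong
    (λ n → solve 2 (λ a b → :- (a :- b) := b :- a) refl (seq x n) (seq y n))
    (null-neg x≃y)

  ≃-trans : ∀ x y z → x ≃ y → y ≃ z → x ≃ z
  ≃-trans x y z x≃y y≃z = null-cong
    (λ n → solve 3 (λ a b c → (a :- b) :+ (b :- c) := a :- c) refl (seq x n) (seq y n) (seq z n))
    (null-+ x≃y y≃z)

  +ℝ-cong : ∀ x y u v → x ≃ y → u ≃ v → x +ℝ u ≃ y +ℝ v
  +ℝ-cong x y u v x≃y u≃v = null-cong
    (λ n → solve 4 (λ a b c d → (a :- b) :+ (c :- d) := (a :+ c) :- (b :+ d)) refl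
      (seq x n) (seq y n) (seq u n) (seq v n))
    (null-+ x≃y u≃v)

  -ℝ-cong : ∀ x y → x ≃ y → -ℝ x ≃ -ℝ y
  -ℝ-cong x y x≃y = null-cong
    (λ n → solve 2 (λ a b → :- (a :- b) := :- a :- :- b) refl (seq x n) (seq y n))
    (null-neg x≃y)

  *ℝ-cong : ∀ x y u v → x ≃ y → u ≃ v → x *ℝ u ≃ y *ℝ v
  *ℝ-cong x y u v x≃y u≃v = null-cong
    (λ n → solve 4 (λ a b c d → a :* (c :- d) :+ d :* (a :- b) := a :* c :- b :* d) refl
      (seq x n) (seq y n) (seq u n) (seq v n))
    (null-+ (null-* {seq x} (cauchy x) u≃v) (null-* {seq v} (cauchy v) x≃y))

  -- Positivity carries a rational gap `ε`. Weak inequalities are expressed as negations of it, so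
  -- they can be proved by contradiction.
  Pos : ℝ → Set
  Pos x = ∃[ ε ] (0ℚ ℚ.< ε × ∃[ N ] (∀ n → N ℕ.≤ n → ε ℚ.< seq x n))

  -∣p∣≤p : ∀ p → ℚ.- ∣ p ∣ ℚ.≤ p
  -∣p∣≤p p with ℚ.≤-total 0ℚ p
  ... | inj₁ 0≤p = ℚ.≤-trans (ℚ.neg-antimono-≤ (ℚ.0≤∣p∣ p)) 0≤p
  ... | inj₂ p≤0 = ℚ.≤-reflexive (trans (cong ℚ.-_ ∣p∣≡-p) (solve 1 (λ a → :- :- a := a) refl p))
    where
    ∣p∣≡-p : ∣ p ∣ ≡ ℚ.- p
    ∣p∣≡-p = trans (sym (ℚ.∣-p∣≡∣p∣ p)) (ℚ.0≤p⇒∣p∣≡p (ℚ.neg-antimono-≤ p≤0))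

  near⇒> : ∀ δ p q → δ ℚ.+ δ ℚ.≤ p → ∣ q ℚ.- p ∣ ℚ.< δ → δ ℚ.< q
  near⇒> δ p q 2δ≤p q~p = begin-strict
    δ                          ≡⟨ solve 1 (λ d → d := (d :+ d) :- d) refl δ ⟩
    δ ℚ.+ δ ℚ.- δ              <⟨ ℚ.+-mono-≤-< 2δ≤p (ℚ.neg-antimono-< q~p) ⟩
    p ℚ.+ ℚ.- ∣ q ℚ.- p ∣      ≤⟨ ℚ.+-monoʳ-≤ p (-∣p∣≤p (q ℚ.- p)) ⟩
    p ℚ.+ (q ℚ.- p)            ≡⟨ solve 2 (λ a b → a :+ (b :- a) := b) refl p q ⟩
    q                          ∎
    where open ℚ.≤-Reasoning

  -- δ is existential so that conversion checking never unfolds the product ½ * ε.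
  halve : ∀ {ε} → 0ℚ ℚ.< ε → ∃[ δ ] (0ℚ ℚ.< δ × δ ℚ.+ δ ≡ ε)
  halve {ε} 0<ε = ½ ℚ.* ε , half-pos 0<ε , halves ε

  Pos-resp : ∀ x y → x ≃ y → Pos x → Pos y
  Pos-resp x y x≃y (ε , 0<ε , M , h) with δ , 0<δ , 2δ≡ε ← halve 0<ε =
    pos (≃-sym x y x≃y δ 0<δ)
    where
    pos : ∃[ N ] (∀ n → N ℕ.≤ n → ∣ seq y n ℚ.- seq x n ∣ ℚ.< δ) → Pos y
    pos (N , k) = δ , 0<δ , M ⊔ N , λ n n≥ →
      near⇒> δ (seq x n) (seq y n)
        (ℚ.≤-trans (ℚ.≤-reflexive 2δ≡ε) (ℚ.<⇒≤ (h n (ℕ.m⊔n≤o⇒m≤o M N n≥))))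
        (k n (ℕ.m⊔n≤o⇒n≤o M N n≥))

  Pos-+ : ∀ x y → Pos x → Pos y → Pos (x +ℝ y)
  Pos-+ x y (ε , 0<ε , M , h) (δ , 0<δ , N , k) =
    ε ℚ.+ δ , ℚ.+-mono-< 0<ε 0<δ , M ⊔ N , λ n n≥ →
      ℚ.+-mono-< (h n (ℕ.m⊔n≤o⇒m≤o M N n≥)) (k n (ℕ.m⊔n≤o⇒n≤o M N n≥))

  0<*0< : ∀ {p q} → 0ℚ ℚ.< p → 0ℚ ℚ.< q → 0ℚ ℚ.< p ℚ.* q
  0<*0< {p} {q} 0<p 0<q = subst (ℚ._< p ℚ.* q) (ℚ.*-zeroʳ p)
    (ℚ.*-monoʳ-<-pos p {{ℚ.positive 0<p}} 0<q)

  Pos-* : ∀ x y → Pos x → Pos y → Pos (x *ℝ y)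
  Pos-* x y (ε , 0<ε , M , h) (δ , 0<δ , N , k) =
    ε ℚ.* δ , 0<*0< 0<ε 0<δ , M ⊔ N , λ n n≥ →
      let ε<x = h n (ℕ.m⊔n≤o⇒m≤o M N n≥) in ℚ.<-trans
        (ℚ.*-monoʳ-<-pos ε {{ℚ.positive 0<ε}} (k n (ℕ.m⊔n≤o⇒n≤o M N n≥)))
        (ℚ.*-monoˡ-<-pos (seq y n)
          {{ℚ.positive (ℚ.<-trans 0<δ (k n (ℕ.m⊔n≤o⇒n≤o M N n≥)))}} ε<x)

  ¬Pos-≤0 : ∀ x → (∀ n → seq x n ℚ.≤ 0ℚ) → ¬ Pos x
  ¬Pos-≤0 x x≤0 (ε , 0<ε , N , h) =
    ℚ.<-irrefl refl (ℚ.<-≤-trans (ℚ.<-trans 0<ε (h N ℕ.≤-refl)) (x≤0 N))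

  -- A single late entry decides: if both entries at `H` were below half the gap, their sum would be
  -- below the gap. The entry that is not below stays above a quarter of the gap from `H` on, by the
  -- Cauchy property.
  Pos-cotrans : ∀ x y → Pos (x +ℝ y) → Pos x ⊎ Pos y
  Pos-cotrans x y (ε , 0<ε , K , h)
    with η , 0<η , 2η≡ε ← halve 0<ε
    with δ , 0<δ , 2δ≡η ← halve 0<η
    with M , hx ← cauchy x δ 0<δ
       | N , hy ← cauchy y δ 0<δ
    = split
    where
    H = K ⊔ (M ⊔ N)
    K≤H = ℕ.m≤m⊔n K (M ⊔ N)
    M≤H = ℕ.≤-trans (ℕ.m≤m⊔n M N) (ℕ.m≤n⊔m K (M ⊔ N))
    N≤H = ℕ.≤-trans (ℕ.m≤n⊔m M N) (ℕ.m≤n⊔m K (M ⊔ N))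
    split : Pos x ⊎ Pos y
    split with η ℚ.≤? seq x H | η ℚ.≤? seq y H
    ... | yes le | _ = inj₁ (δ , 0<δ , H , λ n n≥ →
          near⇒> δ (seq x H) (seq x n) (subst (ℚ._≤ seq x H) (sym 2δ≡η) le)
            (hx n H (ℕ.≤-trans M≤H n≥) M≤H))
    ... | no _ | yes le = inj₂ (δ , 0<δ , H , λ n n≥ →
          near⇒> δ (seq y H) (seq y n) (subst (ℚ._≤ seq y H) (sym 2δ≡η) le)
            (hy n H (ℕ.≤-trans N≤H n≥) N≤H))
    ... | no x≱ | no y≱ = contradiction
          (ℚ.<-trans (subst (seq x H ℚ.+ seq y H ℚ.<_) 2η≡ε
            (ℚ.+-mono-< (ℚ.≰⇒> x≱) (ℚ.≰⇒> y≱))) (h H K≤H))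
          (ℚ.<-irrefl refl)

  -- One entry of size at least `ε` beyond the Cauchy modulus for half of `ε` would already force
  -- positivity, so that modulus serves as the bound.
  ¬Pos⇒eventually< : ∀ x → ¬ Pos x → ∀ ε → 0ℚ ℚ.< ε → ∃[ N ] (∀ n → N ℕ.≤ n → seq x n ℚ.< ε)
  ¬Pos⇒eventually< x x≤0 ε 0<ε
    with δ , 0<δ , 2δ≡ε ← halve 0<ε
    with N , hx ← cauchy x δ 0<δ
    = N , λ n n≥ → ℚ.≰⇒> λ ε≤x → x≤0 (δ , 0<δ , n , λ m m≥ →
        near⇒> δ (seq x n) (seq x m) (subst (ℚ._≤ seq x n) (sym 2δ≡ε) ε≤x)
          (hx m n (ℕ.≤-trans n≥ m≥) n≥))

  -- This turns two negations into an equation; through it, proofs by contradiction can end in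
  -- `Im z ≃ 0ℝ`.
  ≃0-tight : ∀ x → ¬ Pos x → ¬ Pos (-ℝ x) → x ≃ 0ℝ
  ≃0-tight x x≤0 x≥0 = null-cong (λ n → sym (ℚ.+-identityʳ (seq x n))) λ ε 0<ε →
    bound (¬Pos⇒eventually< x x≤0 ε 0<ε) (¬Pos⇒eventually< (-ℝ x) x≥0 ε 0<ε)
    where
    bound : ∀ {ε} → ∃[ M ] (∀ n → M ℕ.≤ n → seq x n ℚ.< ε) →
            ∃[ N ] (∀ n → N ℕ.≤ n → ℚ.- seq x n ℚ.< ε) →
            ∃[ K ] (∀ n → K ℕ.≤ n → ∣ seq x n ∣ ℚ.< ε)
    bound (M , hx) (N , hy) = M ⊔ N , λ n n≥ →
      [ (λ eq → subst (ℚ._< _) (sym eq) (hx n (ℕ.m⊔n≤o⇒m≤o M N n≥)))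
      , (λ eq → subst (ℚ._< _) (sym eq) (hy n (ℕ.m⊔n≤o⇒n≤o M N n≥)))
      ]′ (ℚ.∣p∣≡p∨∣p∣≡-p (seq x n))

open ℝ-Properties

-- Axioms for a half plane, and the complex numbers as a model

-- The upper half plane of a complex-number-like ring: Upper z stands for
-- 0 < Im z, PosReal z for 0 < z.
record HalfPlane (R : CommutativeRing 0ℓ 0ℓ) : Set₁ where
  open CommutativeRing R
  field
    conj            : Carrier → Carrier
    conj-cong       : ∀ {v w} → v ≈ w → conj v ≈ conj w
    conj-+          : ∀ v w → conj (v + w) ≈ conj v + conj w
    conj-*          : ∀ v w → conj (v * w) ≈ conj v * conj w
    Upper           : Carrier → Set
    Upper-resp      : ∀ {v w} → v ≈ w → Upper v → Upper w
    ¬Upper-0        : ¬ Upper 0#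
    Upper-+         : ∀ {v w} → Upper v → Upper w → Upper (v + w)
    Upper-cotrans   : ∀ v w → Upper (v + w) → Upper v ⊎ Upper w
    PosReal         : Carrier → Set
    PosReal-1       : PosReal 1#
    PosReal-*       : ∀ {r s} → PosReal r → PosReal s → PosReal (r * s)
    ¬PosReal-0      : ∀ {r} → PosReal r → ¬ r ≈ 0#
    PosReal⇒conj    : ∀ {r} → PosReal r → conj r ≈ r
    Upper-scale     : ∀ {r w} → PosReal r → Upper w → Upper (r * w)
    ¬Upper-scale    : ∀ {r w} → PosReal r → ¬ Upper w → ¬ Upper (r * w)
    -- Without the double negation this would be Markov's principle. Every use of it aims at a
    -- contradiction, where the double negation can be stripped.
    ¬≈0⇒norm        : ∀ {w} → ¬ w ≈ 0# → ¬ ¬ PosReal (w * conj w)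

module ℂ-Properties where
  open ≡ using (refl; cong; subst)
  open +-*-Solver using (solve; _:=_; _:+_; _:*_; _:-_; :-_; con)

  ≃ℂ-pointwise : ∀ w z → (∀ n → seq (Re w) n ≡ seq (Re z) n) →
                 (∀ n → seq (Im w) n ≡ seq (Im z) n) → w ≃ℂ z
  ≃ℂ-pointwise w z re im = ≃-pointwise (Re w) (Re z) re , ≃-pointwise (Im w) (Im z) im

  module ℂ-ring = RawRing ℂ-rawRing

  -ℂ_ : ℂ → ℂ
  -ℂ_ = ℂ-ring.-_

  +ℂ-cong : ∀ {w z u v} → w ≃ℂ z → u ≃ℂ v → w +ℂ u ≃ℂ z +ℂ v
  +ℂ-cong {w} {z} {u} {v} (p , q) (r , s) =
    +ℝ-cong (Re w) (Re z) (Re u) (Re v) p r , +ℝ-cong (Im w) (Im z) (Im u) (Im v) q s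

  *ℂ-cong : ∀ {w z u v} → w ≃ℂ z → u ≃ℂ v → w *ℂ u ≃ℂ z *ℂ v
  *ℂ-cong {w} {z} {u} {v} (p , q) (r , s) =
    +ℝ-cong (Re w *ℝ Re u) (Re z *ℝ Re v) (-ℝ (Im w *ℝ Im u)) (-ℝ (Im z *ℝ Im v))
      (*ℝ-cong (Re w) (Re z) (Re u) (Re v) p r)
      (-ℝ-cong (Im w *ℝ Im u) (Im z *ℝ Im v) (*ℝ-cong (Im w) (Im z) (Im u) (Im v) q s)) ,
    +ℝ-cong (Re w *ℝ Im u) (Re z *ℝ Im v) (Im w *ℝ Re u) (Im z *ℝ Re v)
      (*ℝ-cong (Re w) (Re z) (Im u) (Im v) p s)
      (*ℝ-cong (Im w) (Im z) (Re u) (Re v) q r)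

  -ℂ-cong : ∀ {w z} → w ≃ℂ z → -ℂ w ≃ℂ -ℂ z
  -ℂ-cong {w} {z} (p , q) = -ℝ-cong (Re w) (Re z) p , -ℝ-cong (Im w) (Im z) q

  ℂ-isCommutativeRing : IsCommutativeRing _≃ℂ_ _+ℂ_ _*ℂ_ -ℂ_ (ofReal 0ℝ) (ofReal 1ℝ)
  ℂ-isCommutativeRing = record
    { isRing = record
      { +-isAbelianGroup = record
        { isGroup = record
          { isMonoid = record
            { isSemigroup = record
              { isMagma = record
                { isEquivalence = record
                  { refl  = λ {z} → ≃ℂ-pointwise z z (λ _ → refl) (λ _ → refl)
                  ; sym   = λ {w} {z} (p , q) → ≃-sym (Re w) (Re z) p , ≃-sym (Im w) (Im z) q
                  ; trans = λ {u} {v} {w} → ≃ℂ-trans {u} {v} {w}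
                  }
                ; ∙-cong = λ {w} {z} {u} {v} → +ℂ-cong {w} {z} {u} {v}
                }
              ; assoc = +-assoc
              }
            ; identity = +-identityˡ , +-identityʳ
            }
          ; inverse = -‿inverseˡ , -‿inverseʳ
          ; ⁻¹-cong = λ {w} {z} → -ℂ-cong {w} {z}
          }
        ; comm = +-comm
        }
      ; *-cong     = λ {w} {z} {u} {v} → *ℂ-cong {w} {z} {u} {v}
      ; *-assoc    = *-assoc
      ; *-identity = *-identityˡ , *-identityʳ
      ; distrib    = distribˡ , distribʳ
      }
    ; *-comm = *-comm
    }
    where
    +-identityˡ : ∀ z → ofReal 0ℝ +ℂ z ≃ℂ z
    +-identityˡ z = ≃ℂ-pointwise (ofReal 0ℝ +ℂ z) z (λ n → ℚ.+-identityˡ (seq (Re z) n)) (λ n → ℚ.+-identityˡ (seq (Im z) n))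
    +-identityʳ : ∀ z → z +ℂ ofReal 0ℝ ≃ℂ z
    +-identityʳ z = ≃ℂ-pointwise (z +ℂ ofReal 0ℝ) z (λ n → ℚ.+-identityʳ (seq (Re z) n)) (λ n → ℚ.+-identityʳ (seq (Im z) n))
    -‿inverseˡ : ∀ z → (-ℂ z) +ℂ z ≃ℂ ofReal 0ℝ
    -‿inverseˡ z = ≃ℂ-pointwise ((-ℂ z) +ℂ z) (ofReal 0ℝ) (λ n → ℚ.+-inverseˡ (seq (Re z) n)) (λ n → ℚ.+-inverseˡ (seq (Im z) n))
    -‿inverseʳ : ∀ z → z +ℂ (-ℂ z) ≃ℂ ofReal 0ℝ
    -‿inverseʳ z = ≃ℂ-pointwise (z +ℂ (-ℂ z)) (ofReal 0ℝ) (λ n → ℚ.+-inverseʳ (seq (Re z) n)) (λ n → ℚ.+-inverseʳ (seq (Im z) n))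
    *-identityˡ : ∀ z → ofReal 1ℝ *ℂ z ≃ℂ z
    *-identityˡ z = ≃ℂ-pointwise (ofReal 1ℝ *ℂ z) z
      (λ n → solve 2 (λ a b → con 1ℚ :* a :+ :- (con 0ℚ :* b) := a) refl (seq (Re z) n) (seq (Im z) n))
      (λ n → solve 2 (λ a b → con 1ℚ :* b :+ con 0ℚ :* a := b) refl (seq (Re z) n) (seq (Im z) n))
    *-identityʳ : ∀ z → z *ℂ ofReal 1ℝ ≃ℂ z
    *-identityʳ z = ≃ℂ-pointwise (z *ℂ ofReal 1ℝ) z
      (λ n → solve 2 (λ a b → a :* con 1ℚ :+ :- (b :* con 0ℚ) := a) refl (seq (Re z) n) (seq (Im z) n))
      (λ n → solve 2 (λ a b → a :* con 0ℚ :+ b :* con 1ℚ := b) refl (seq (Re z) n) (seq (Im z) n))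
    +-assoc : ∀ u v w → (u +ℂ v) +ℂ w ≃ℂ u +ℂ (v +ℂ w)
    +-assoc u v w = ≃ℂ-pointwise ((u +ℂ v) +ℂ w) (u +ℂ (v +ℂ w))
      (λ n → ℚ.+-assoc (seq (Re u) n) (seq (Re v) n) (seq (Re w) n))
      (λ n → ℚ.+-assoc (seq (Im u) n) (seq (Im v) n) (seq (Im w) n))
    +-comm : ∀ u v → u +ℂ v ≃ℂ v +ℂ u
    +-comm u v = ≃ℂ-pointwise (u +ℂ v) (v +ℂ u)
      (λ n → ℚ.+-comm (seq (Re u) n) (seq (Re v) n))
      (λ n → ℚ.+-comm (seq (Im u) n) (seq (Im v) n))
    *-comm : ∀ u v → u *ℂ v ≃ℂ v *ℂ u
    *-comm u v = ≃ℂ-pointwise (u *ℂ v) (v *ℂ u)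
      (λ n → solve 4 (λ a b c d → a :* c :+ :- (b :* d) := c :* a :+ :- (d :* b)) refl
        (seq (Re u) n) (seq (Im u) n) (seq (Re v) n) (seq (Im v) n))
      (λ n → solve 4 (λ a b c d → a :* d :+ b :* c := c :* b :+ d :* a) refl
        (seq (Re u) n) (seq (Im u) n) (seq (Re v) n) (seq (Im v) n))
    *-assoc : ∀ u v w → (u *ℂ v) *ℂ w ≃ℂ u *ℂ (v *ℂ w)
    *-assoc u v w = ≃ℂ-pointwise ((u *ℂ v) *ℂ w) (u *ℂ (v *ℂ w))
      (λ n → solve 6 (λ a b c d e f →
          (a :* c :+ :- (b :* d)) :* e :+ :- ((a :* d :+ b :* c) :* f) :=
          a :* (c :* e :+ :- (d :* f)) :+ :- (b :* (c :* f :+ d :* e))) refl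
        (seq (Re u) n) (seq (Im u) n) (seq (Re v) n) (seq (Im v) n) (seq (Re w) n) (seq (Im w) n))
      (λ n → solve 6 (λ a b c d e f →
          (a :* c :+ :- (b :* d)) :* f :+ (a :* d :+ b :* c) :* e :=
          a :* (c :* f :+ d :* e) :+ b :* (c :* e :+ :- (d :* f))) refl
        (seq (Re u) n) (seq (Im u) n) (seq (Re v) n) (seq (Im v) n) (seq (Re w) n) (seq (Im w) n))
    distribˡ : ∀ u v w → u *ℂ (v +ℂ w) ≃ℂ u *ℂ v +ℂ u *ℂ w
    distribˡ u v w = ≃ℂ-pointwise (u *ℂ (v +ℂ w)) (u *ℂ v +ℂ u *ℂ w)
      (λ n → solve 6 (λ a b c d e f →
          a :* (c :+ e) :+ :- (b :* (d :+ f)) :=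
          (a :* c :+ :- (b :* d)) :+ (a :* e :+ :- (b :* f))) refl
        (seq (Re u) n) (seq (Im u) n) (seq (Re v) n) (seq (Im v) n) (seq (Re w) n) (seq (Im w) n))
      (λ n → solve 6 (λ a b c d e f →
          a :* (d :+ f) :+ b :* (c :+ e) :=
          (a :* d :+ b :* c) :+ (a :* f :+ b :* e)) refl
        (seq (Re u) n) (seq (Im u) n) (seq (Re v) n) (seq (Im v) n) (seq (Re w) n) (seq (Im w) n))
    ≃ℂ-trans : ∀ {u v w} → u ≃ℂ v → v ≃ℂ w → u ≃ℂ w
    ≃ℂ-trans {u} {v} {w} (p , q) (r , s) =
      ≃-trans (Re u) (Re v) (Re w) p r , ≃-trans (Im u) (Im v) (Im w) q s
    distribʳ : ∀ u v w → (v +ℂ w) *ℂ u ≃ℂ v *ℂ u +ℂ w *ℂ u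
    distribʳ u v w = ≃ℂ-trans {(v +ℂ w) *ℂ u} {u *ℂ (v +ℂ w)} {v *ℂ u +ℂ w *ℂ u} (*-comm (v +ℂ w) u)
      (≃ℂ-trans {u *ℂ (v +ℂ w)} {u *ℂ v +ℂ u *ℂ w} {v *ℂ u +ℂ w *ℂ u} (distribˡ u v w)
        (+ℂ-cong {u *ℂ v} {v *ℂ u} {u *ℂ w} {w *ℂ u} (*-comm u v) (*-comm u w)))

  ℂ-commutativeRing : CommutativeRing 0ℓ 0ℓ
  ℂ-commutativeRing = record { isCommutativeRing = ℂ-isCommutativeRing }

  conjℂ : ℂ → ℂ
  conjℂ z = Re z +i (-ℝ Im z)

  PosRealℂ : ℂ → Set
  PosRealℂ z = Im z ≃ 0ℝ × Pos (Re z)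

  p*p≥0 : ∀ p → 0ℚ ℚ.≤ p ℚ.* p
  p*p≥0 p with ℚ.≤-total 0ℚ p
  ... | inj₁ 0≤p = ℚ.nonNegative⁻¹ _ {{ℚ.nonNeg*nonNeg⇒nonNeg p {{ℚ.nonNegative 0≤p}} p {{ℚ.nonNegative 0≤p}}}}
  ... | inj₂ p≤0 = subst (0ℚ ℚ.≤_) (solve 1 (λ a → (:- a) :* (:- a) := a :* a) refl p)
    (ℚ.nonNegative⁻¹ _ {{ℚ.nonNeg*nonNeg⇒nonNeg (ℚ.- p) {{0≤-p}} (ℚ.- p) {{0≤-p}}}})
    where
    0≤-p : ℚ.NonNegative (ℚ.- p)
    0≤-p = ℚ.nonNegative (ℚ.neg-antimono-≤ p≤0)

  ≃0-*ʳ : ∀ x y → y ≃ 0ℝ → x *ℝ y ≃ 0ℝ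
  ≃0-*ʳ x y y≃0 = ≃-trans (x *ℝ y) (x *ℝ 0ℝ) 0ℝ
    (*ℝ-cong x x y 0ℝ (≃-refl x) y≃0)
    (≃-pointwise (x *ℝ 0ℝ) 0ℝ (λ n → ℚ.*-zeroʳ (seq x n)))

  ≃0-*ˡ : ∀ x y → x ≃ 0ℝ → x *ℝ y ≃ 0ℝ
  ≃0-*ˡ x y x≃0 = ≃-trans (x *ℝ y) (y *ℝ x) 0ℝ
    (≃-pointwise (x *ℝ y) (y *ℝ x) (λ n → ℚ.*-comm (seq x n) (seq y n)))
    (≃0-*ʳ y x x≃0)

  +-≃0ʳ : ∀ x y → y ≃ 0ℝ → x +ℝ y ≃ x
  +-≃0ʳ x y y≃0 = ≃-trans (x +ℝ y) (x +ℝ 0ℝ) x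
    (+ℝ-cong x x y 0ℝ (≃-refl x) y≃0)
    (≃-pointwise (x +ℝ 0ℝ) x (λ n → ℚ.+-identityʳ (seq x n)))

  Im-scale : ∀ r w → Im r ≃ 0ℝ → Im (r *ℂ w) ≃ Re r *ℝ Im w
  Im-scale r w r-real = +-≃0ʳ (Re r *ℝ Im w) (Im r *ℝ Re w) (≃0-*ˡ (Im r) (Re w) r-real)

  -- If the product were positive, `y` could not be negative either; tightness then makes `y` zero,
  -- and the product with it.
  ¬Pos-* : ∀ x y → Pos x → ¬ Pos y → ¬ Pos (x *ℝ y)
  ¬Pos-* x y x>0 y≤0 xy>0 = ¬Pos-≤0 0ℝ (λ _ → ℚ.≤-refl)
    (Pos-resp (x *ℝ y) 0ℝ (≃0-*ʳ x y (≃0-tight y y≤0 y≥0)) xy>0)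
    where
    y≥0 : ¬ Pos (-ℝ y)
    y≥0 -y>0 = ¬Pos-≤0 (x *ℝ y +ℝ x *ℝ (-ℝ y))
      (λ n → ℚ.≤-reflexive (solve 2 (λ a b → a :* b :+ a :* (:- b) := con 0ℚ) refl (seq x n) (seq y n)))
      (Pos-+ (x *ℝ y) (x *ℝ (-ℝ y)) xy>0 (Pos-* x (-ℝ y) x>0 -y>0))

  -- Either sign of `x` would make its square positive. Writing that square as the full sum minus
  -- the square of `y`, cotransitivity hands positivity on to the sum.
  ¬Pos-sum-of-squares : ∀ x y → ¬ Pos (x *ℝ x +ℝ y *ℝ y) → x ≃ 0ℝ
  ¬Pos-sum-of-squares x y ¬pos = ≃0-tight x
    (λ x>0 → ¬pos (enough (Pos-* x x x>0 x>0)))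
    (λ -x>0 → ¬pos (enough (Pos-resp ((-ℝ x) *ℝ (-ℝ x)) (x *ℝ x)
      (≃-pointwise ((-ℝ x) *ℝ (-ℝ x)) (x *ℝ x)
        (λ n → solve 1 (λ a → (:- a) :* (:- a) := a :* a) refl (seq x n)))
      (Pos-* (-ℝ x) (-ℝ x) -x>0 -x>0))))
    where
    enough : Pos (x *ℝ x) → Pos (x *ℝ x +ℝ y *ℝ y)
    enough xx>0 = [ (λ p → p) , (λ -yy>0 → contradiction -yy>0
        (¬Pos-≤0 (-ℝ (y *ℝ y)) (λ n → ℚ.neg-antimono-≤ (p*p≥0 (seq y n))))) ]′
      (Pos-cotrans (x *ℝ x +ℝ y *ℝ y) (-ℝ (y *ℝ y))
        (Pos-resp (x *ℝ x) (x *ℝ x +ℝ y *ℝ y +ℝ (-ℝ (y *ℝ y)))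
          (≃-pointwise (x *ℝ x) (x *ℝ x +ℝ y *ℝ y +ℝ (-ℝ (y *ℝ y)))
            (λ n → solve 2 (λ a b → a := a :+ b :+ :- b) refl (seq x n ℚ.* seq x n) (seq y n ℚ.* seq y n)))
          xx>0))

  ℂ-halfPlane : HalfPlane ℂ-commutativeRing
  ℂ-halfPlane = record
    { conj          = conjℂ
    ; conj-cong     = λ {v} {w} (p , q) → p , -ℝ-cong (Im v) (Im w) q
    ; conj-+        = λ v w → ≃ℂ-pointwise (conjℂ (v +ℂ w)) (conjℂ v +ℂ conjℂ w) (λ _ → refl)
        (λ n → ℚ.neg-distrib-+ (seq (Im v) n) (seq (Im w) n))
    ; conj-*        = λ v w → ≃ℂ-pointwise (conjℂ (v *ℂ w)) (conjℂ v *ℂ conjℂ w)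
        (λ n → solve 4 (λ a b c d → a :* c :+ :- (b :* d) := a :* c :+ :- ((:- b) :* (:- d))) refl
          (seq (Re v) n) (seq (Im v) n) (seq (Re w) n) (seq (Im w) n))
        (λ n → solve 4 (λ a b c d → :- (a :* d :+ b :* c) := a :* (:- d) :+ (:- b) :* c) refl
          (seq (Re v) n) (seq (Im v) n) (seq (Re w) n) (seq (Im w) n))
    ; Upper         = λ z → Pos (Im z)
    ; Upper-resp    = λ {v} {w} (_ , q) → Pos-resp (Im v) (Im w) q
    ; ¬Upper-0      = ¬Pos-≤0 0ℝ (λ _ → ℚ.≤-refl)
    ; Upper-+       = λ {v} {w} → Pos-+ (Im v) (Im w)
    ; Upper-cotrans = λ v w → Pos-cotrans (Im v) (Im w)
    ; PosReal       = PosRealℂ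
    ; PosReal-1     = ≃-refl 0ℝ , (½ , ℚ.positive⁻¹ ½ , 0 , λ _ _ → ℚ.*<* (ℤ.+<+ (ℕ.s≤s (ℕ.s≤s ℕ.z≤n))))
    ; PosReal-*     = λ {r} {s} (r≃ , r>0) (s≃ , s>0) →
        ≃-trans (Im (r *ℂ s)) (Re r *ℝ Im s) 0ℝ (Im-scale r s r≃) (≃0-*ʳ (Re r) (Im s) s≃) ,
        Pos-resp (Re r *ℝ Re s) (Re (r *ℂ s))
          (≃-sym (Re (r *ℂ s)) (Re r *ℝ Re s)
            (+-≃0ʳ (Re r *ℝ Re s) (-ℝ (Im r *ℝ Im s))
              (-ℝ-cong (Im r *ℝ Im s) 0ℝ (≃0-*ˡ (Im r) (Im s) r≃))))
          (Pos-* (Re r) (Re s) r>0 s>0)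
    ; ¬PosReal-0    = λ {r} (_ , r>0) (r≃0 , _) →
        ¬Pos-≤0 0ℝ (λ _ → ℚ.≤-refl) (Pos-resp (Re r) 0ℝ r≃0 r>0)
    ; PosReal⇒conj  = λ {r} (r≃ , _) → ≃-refl (Re r) ,
        ≃-trans (-ℝ Im r) (-ℝ 0ℝ) (Im r) (-ℝ-cong (Im r) 0ℝ r≃)
          (≃-sym (Im r) (-ℝ 0ℝ) r≃)
    ; Upper-scale   = λ {r} {w} (r≃ , r>0) w>0 →
        Pos-resp (Re r *ℝ Im w) (Im (r *ℂ w)) (≃-sym (Im (r *ℂ w)) (Re r *ℝ Im w) (Im-scale r w r≃))
          (Pos-* (Re r) (Im w) r>0 w>0)
    ; ¬Upper-scale  = λ {r} {w} (r≃ , r>0) w≤0 rw>0 → ¬Pos-* (Re r) (Im w) r>0 w≤0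
        (Pos-resp (Im (r *ℂ w)) (Re r *ℝ Im w) (Im-scale r w r≃) rw>0)
    ; ¬≈0⇒norm      = λ {w} w≄0 ¬norm → w≄0 (zero-norm w ¬norm)
    }
    where
    zero-norm : ∀ w → ¬ PosRealℂ (w *ℂ conjℂ w) → w ≃ℂ ofReal 0ℝ
    zero-norm w ¬norm =
      ¬Pos-sum-of-squares x y (λ h → ¬norm (im≃0 , Pos-resp (x *ℝ x +ℝ y *ℝ y) (Re (w *ℂ conjℂ w))
        (≃-pointwise (x *ℝ x +ℝ y *ℝ y) (Re (w *ℂ conjℂ w))
          (λ n → solve 2 (λ a b → a :* a :+ b :* b := a :* a :+ :- (b :* (:- b))) refl (seq x n) (seq y n))) h)) ,
      ¬Pos-sum-of-squares y x (λ h → ¬norm (im≃0 , Pos-resp (y *ℝ y +ℝ x *ℝ x) (Re (w *ℂ conjℂ w))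
        (≃-pointwise (y *ℝ y +ℝ x *ℝ x) (Re (w *ℂ conjℂ w))
          (λ n → solve 2 (λ a b → b :* b :+ a :* a := a :* a :+ :- (b :* (:- b))) refl (seq x n) (seq y n))) h))
      where
      x = Re w
      y = Im w
      im≃0 : Im (w *ℂ conjℂ w) ≃ 0ℝ
      im≃0 = ≃-pointwise (Im (w *ℂ conjℂ w)) 0ℝ
        (λ n → solve 2 (λ a b → a :* (:- b) :+ b :* a := con 0ℚ) refl (seq x n) (seq y n))

open ℂ-Properties

-- Multiaffine polynomials without zeros on products of half planes

data Kind : Set where
  closed opened : Kind

module Stable (R : CommutativeRing 0ℓ 0ℓ) (H : HalfPlane R) where
  open CommutativeRing R
  open HalfPlane H
  open RingProperties ring using (-‿distribʳ-*; -‿+-comm; -0#≈0#)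
  open SemiringSolver commutativeSemiring using (solve; _:=_; _:+_; _:*_)
  open SetoidReasoning setoid

  NonNeg : Carrier → Set
  NonNeg w = ¬ Upper (- w)

  NonNeg-resp : ∀ {v w} → v ≈ w → NonNeg v → NonNeg w
  NonNeg-resp v≈w v≥0 = v≥0 ∘ Upper-resp (-‿cong (sym v≈w))

  NonNeg-0 : ∀ {w} → w ≈ 0# → NonNeg w
  NonNeg-0 w≈0 = ¬Upper-0 ∘ Upper-resp (trans (-‿cong w≈0) -0#≈0#)

  NonNeg-+ : ∀ {v w} → NonNeg v → NonNeg w → NonNeg (v + w)
  NonNeg-+ {v} {w} v≥0 w≥0 =
    [ v≥0 , w≥0 ]′ ∘ Upper-cotrans (- v) (- w) ∘ Upper-resp (sym (-‿+-comm v w))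

  NonNeg-scale : ∀ {r w} → PosReal r → NonNeg w → NonNeg (r * w)
  NonNeg-scale {r} {w} r>0 w≥0 = ¬Upper-scale r>0 w≥0 ∘ Upper-resp (-‿distribʳ-* r w)

  Upper+NonNeg : ∀ {v w} → Upper v → NonNeg w → Upper (v + w)
  Upper+NonNeg {v} {w} v>0 w≥0 =
    [ (λ h → h) , (λ -w>0 → contradiction -w>0 w≥0) ]′
      (Upper-cotrans (v + w) (- w) (Upper-resp (sym eq) v>0))
    where
    eq : v + w + - w ≈ v
    eq = trans (+-assoc v w (- w)) (trans (+-congˡ (-‿inverseʳ w)) (+-identityʳ v))

  Upper⇒NonNeg : ∀ {w} → Upper w → NonNeg w
  Upper⇒NonNeg {w} w>0 -w>0 = ¬Upper-0 (Upper-resp (-‿inverseʳ w) (Upper-+ w>0 -w>0))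

  conj-0 : conj 0# ≈ 0#
  conj-0 = begin
    conj 0#                            ≈⟨ +-identityʳ _ ⟨
    conj 0# + 0#                       ≈⟨ +-congˡ (-‿inverseʳ (conj 0#)) ⟨
    conj 0# + (conj 0# + - conj 0#)    ≈⟨ +-assoc _ _ _ ⟨
    conj 0# + conj 0# + - conj 0#      ≈⟨ +-congʳ (conj-+ 0# 0#) ⟨
    conj (0# + 0#) + - conj 0#         ≈⟨ +-congʳ (conj-cong (+-identityʳ 0#)) ⟩
    conj 0# + - conj 0#                ≈⟨ -‿inverseʳ (conj 0#) ⟩
    0#                                 ∎

  -- The product of the two norms is positive, yet it contains the factor `v * w`.
  *-≉0 : ∀ {v w} → ¬ v ≈ 0# → ¬ w ≈ 0# → ¬ v * w ≈ 0#
  *-≉0 {v} {w} v≉0 w≉0 vw≈0 = ¬≈0⇒norm v≉0 λ v² → ¬≈0⇒norm w≉0 λ w² →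
    ¬PosReal-0 (PosReal-* v² w²) (begin
      v * conj v * (w * conj w)    ≈⟨ solve 4 (λ a b c d → a :* b :* (c :* d) := a :* c :* (b :* d)) refl v (conj v) w (conj w) ⟩
      v * w * (conj v * conj w)    ≈⟨ *-congʳ vw≈0 ⟩
      0# * (conj v * conj w)       ≈⟨ zeroˡ _ ⟩
      0#                           ∎)

  -- Multiaffine polynomials: p +X· q stands for p + X q, where X is the first variable.
  infix 5 _+X·_

  data Poly : List Kind → Set where
    const : Carrier → Poly []
    _+X·_ : ∀ {k ks} → Poly ks → Poly ks → Poly (k ∷ ks)

  -- Applied to the two coefficients of `p +X· q`, with `r` and `s` the coordinates of the first
  -- variable, this fixes that variable and leaves a polynomial in the others. Induction on the
  -- number of variables passes through it.
  combine : ∀ {ks} → Carrier → Carrier → Poly ks → Poly ks → Poly ks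
  combine r s (const a)   (const b)   = const (r * a + s * b)
  combine r s (p₀ +X· p₁) (q₀ +X· q₁) = combine r s p₀ q₀ +X· combine r s p₁ q₁

  infixl 6 _⊞_

  _⊞_ : ∀ {ks} → Poly ks → Poly ks → Poly ks
  const a     ⊞ const b     = const (a + b)
  (p₀ +X· p₁) ⊞ (q₀ +X· q₁) = p₀ ⊞ q₀ +X· p₁ ⊞ q₁

  zeroPoly : ∀ {ks} → Poly ks
  zeroPoly {[]}    = const 0#
  zeroPoly {_ ∷ _} = zeroPoly +X· zeroPoly

  D : ∀ {ks} → Poly ks → Poly ks
  D (const _)  = const 0#
  D (p +X· q) = D p ⊞ q +X· D q

  -- The four entries are the coefficients of 1, y, x and x y in `(x + y) p + x y D p`.
  T : ∀ {ks} → Poly ks → Poly (closed ∷ opened ∷ ks)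
  T p = (zeroPoly +X· p) +X· (p +X· D p)

  -- (r , z) represents z / r for a positive real r; homogeneous coordinates avoid division.
  Scaled : Set
  Scaled = Carrier × Carrier

  Coordinates : List Kind → Set
  Coordinates = All (λ _ → Scaled)

  -- This is the value at the points z / r multiplied by the product of all scales r; on positive
  -- scales the zeros are the same.
  value : ∀ {ks} → Poly ks → Coordinates ks → Carrier
  value (const a)  []            = a
  value (p +X· q) ((r , z) ∷ w) = r * value p w + z * value q w

  value-combine : ∀ {ks} r s (p q : Poly ks) w →
                 value (combine r s p q) w ≈ r * value p w + s * value q w
  value-combine r s (const a) (const b) [] = refl
  value-combine r s (p₀ +X· p₁) (q₀ +X· q₁) ((t , z) ∷ w) =
    trans (+-cong (*-congˡ (value-combine r s p₀ q₀ w)) (*-congˡ (value-combine r s p₁ q₁ w)))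
      (solve 8 (λ r s t z a b c d →
          t :* (r :* a :+ s :* c) :+ z :* (r :* b :+ s :* d) :=
          r :* (t :* a :+ z :* b) :+ s :* (t :* c :+ z :* d)) refl
        r s t z (value p₀ w) (value p₁ w) (value q₀ w) (value q₁ w))

  value-⊞ : ∀ {ks} (p q : Poly ks) w → value (p ⊞ q) w ≈ value p w + value q w
  value-⊞ (const a) (const b) [] = refl
  value-⊞ (p₀ +X· p₁) (q₀ +X· q₁) ((t , z) ∷ w) =
    trans (+-cong (*-congˡ (value-⊞ p₀ q₀ w)) (*-congˡ (value-⊞ p₁ q₁ w)))
      (solve 6 (λ t z a b c d →
          t :* (a :+ c) :+ z :* (b :+ d) := (t :* a :+ z :* b) :+ (t :* c :+ z :* d)) refl
        t z (value p₀ w) (value p₁ w) (value q₀ w) (value q₁ w))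

  value-zeroPoly : ∀ {ks} w → value (zeroPoly {ks}) w ≈ 0#
  value-zeroPoly {[]}    [] = refl
  value-zeroPoly {_ ∷ _} ((t , z) ∷ w) = begin
    t * value zeroPoly w + z * value zeroPoly w ≈⟨ +-cong (*-congˡ (value-zeroPoly w)) (*-congˡ (value-zeroPoly w)) ⟩
    t * 0# + z * 0#                           ≈⟨ +-cong (zeroʳ t) (zeroʳ z) ⟩
    0# + 0#                                   ≈⟨ +-identityʳ 0# ⟩
    0#                                        ∎

  -- The partial derivative `q` is free of the first variable, so homogeneity supplies the factor
  -- `r` in front of it.
  value-D : ∀ {k ks} (p q : Poly ks) r z w →
           value (D {k ∷ ks} (p +X· q)) ((r , z) ∷ w) ≈
           (r * value (D p) w + z * value (D q) w) + r * value q w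
  value-D p q r z w = trans (+-congʳ (*-congˡ (value-⊞ (D p) q w)))
    (solve 5 (λ r z a b c → r :* (a :+ b) :+ z :* c := (r :* a :+ z :* c) :+ r :* b) refl
      r z (value (D p) w) (value q w) (value (D q) w))

  value-D-combine : ∀ {ks} r s (p q : Poly ks) w →
                   value (D (combine r s p q)) w ≈ r * value (D p) w + s * value (D q) w
  value-D-combine r s (const a) (const b) [] = sym (trans (+-cong (zeroʳ r) (zeroʳ s)) (+-identityʳ 0#))
  value-D-combine {k ∷ _} r s (p₀ +X· p₁) (q₀ +X· q₁) ((t , z) ∷ w) = begin
    value (D {k ∷ _} (combine r s p₀ q₀ +X· combine r s p₁ q₁)) ((t , z) ∷ w)
      ≈⟨ value-D {k} (combine r s p₀ q₀) (combine r s p₁ q₁) t z w ⟩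
    (t * value (D (combine r s p₀ q₀)) w + z * value (D (combine r s p₁ q₁)) w) + t * value (combine r s p₁ q₁) w
      ≈⟨ +-cong (+-cong (*-congˡ (value-D-combine r s p₀ q₀ w)) (*-congˡ (value-D-combine r s p₁ q₁ w)))
           (*-congˡ (value-combine r s p₁ q₁ w)) ⟩
    (t * (r * Dp₀ + s * Dq₀) + z * (r * Dp₁ + s * Dq₁)) + t * (r * value p₁ w + s * value q₁ w)
      ≈⟨ solve 10 (λ r s t z a b c d e f →
           (t :* (r :* a :+ s :* b) :+ z :* (r :* c :+ s :* d)) :+ t :* (r :* e :+ s :* f) :=
           r :* ((t :* a :+ z :* c) :+ t :* e) :+ s :* ((t :* b :+ z :* d) :+ t :* f)) refl
           r s t z Dp₀ Dq₀ Dp₁ Dq₁ (value p₁ w) (value q₁ w) ⟩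
    r * ((t * Dp₀ + z * Dp₁) + t * value p₁ w) + s * ((t * Dq₀ + z * Dq₁) + t * value q₁ w)
      ≈⟨ +-cong (*-congˡ (value-D {k} p₀ p₁ t z w)) (*-congˡ (value-D {k} q₀ q₁ t z w)) ⟨
    r * value (D {k ∷ _} (p₀ +X· p₁)) ((t , z) ∷ w) + s * value (D {k ∷ _} (q₀ +X· q₁)) ((t , z) ∷ w) ∎
    where
    Dp₀ = value (D p₀) w
    Dq₀ = value (D q₀) w
    Dp₁ = value (D p₁) w
    Dq₁ = value (D q₁) w

  module Rotated (c : Carrier) where

    -- Multiplied by `c`, the descent variables will lie on the real axis, so they need the closed
    -- half plane. The ascent variables get the open one, which also keeps them away from zero.
    Admissible : Kind → Scaled → Set
    Admissible closed (r , z) = PosReal r × NonNeg (c * z)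
    Admissible opened (r , z) = PosReal r × Upper (c * z)

    Domain : ∀ {ks} → Coordinates ks → Set
    Domain []              = ⊤
    Domain (_∷_ {k} s w) = Admissible k s × Domain w

    NonVanishing : ∀ {ks} → Poly ks → Set
    NonVanishing {ks} p = ∀ w → Domain w → ¬ value p w ≈ 0#

    admissible-scale : ∀ k {r z} → Admissible k (r , z) → PosReal r
    admissible-scale closed = proj₁
    admissible-scale opened = proj₁

    -- The new point is z / r moved by t / (s r), a positive multiple of `t`. Such a move leads into
    -- the half plane even from its boundary.
    admissible-shift : ∀ k {r z s t} → Admissible k (r , z) → PosReal s → Upper (c * t) →
                       Admissible k (s * r , s * z + t)
    admissible-shift k {r} {z} {s} {t} adm s>0 t>0 = go k adm
      where
      eq : c * t + s * (c * z) ≈ c * (s * z + t)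
      eq = solve 4 (λ c s z t → c :* t :+ s :* (c :* z) := c :* (s :* z :+ t)) refl c s z t
      go : ∀ k → Admissible k (r , z) → Admissible k (s * r , s * z + t)
      go closed (r>0 , z≥0) = PosReal-* s>0 r>0 ,
        Upper⇒NonNeg (Upper-resp eq (Upper+NonNeg t>0 (NonNeg-scale s>0 z≥0)))
      go opened (r>0 , z>0) = PosReal-* s>0 r>0 ,
        Upper-resp eq (Upper-+ t>0 (Upper-scale s>0 z>0))

    -- If Im (c P q̄) < 0, then the value P = r p + z q vanishes after moving
    -- z by -P/q = -P q̄/|q|², a move that stays in the domain.
    NonNeg-slope : ∀ k {ks} (p q : Poly ks) → NonVanishing {k ∷ ks} (p +X· q) →
                   ∀ r z w → Domain {k ∷ ks} ((r , z) ∷ w) →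
                   NonNeg (c * ((r * value p w + z * value q w) * conj (value q w)))
    NonNeg-slope k p q pq≉0 r z w (rz∈ , w∈) neg = ¬≈0⇒norm q≉0 λ |q|²>0 →
      pq≉0 ((N * r , N * z + t) ∷ w) (admissible-shift k rz∈ |q|²>0 t>0 , w∈) zero-value
      where
      q′ = value q w
      P = r * value p w + z * q′
      N = q′ * conj q′
      t = - (P * conj q′)
      t>0 : Upper (c * t)
      t>0 = Upper-resp (-‿distribʳ-* c (P * conj q′)) neg
      -- If `q′` vanished, the slope expression would be zero, which is not negative.
      q≉0 : ¬ q′ ≈ 0#
      q≉0 q≈0 = NonNeg-0 (trans (*-congˡ (trans (*-congˡ (trans (conj-cong q≈0) conj-0)) (zeroʳ P))) (zeroʳ c)) neg
      zero-value : N * r * value p w + (N * z + t) * q′ ≈ 0#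
      zero-value = begin
        N * r * value p w + (N * z + t) * q′
          ≈⟨ solve 6 (λ N r z t p q → N :* r :* p :+ (N :* z :+ t) :* q := (r :* p :+ z :* q) :* N :+ q :* t) refl
               N r z t (value p w) q′ ⟩
        P * (q′ * conj q′) + q′ * t
          ≈⟨ +-cong (solve 3 (λ P q q̄ → P :* (q :* q̄) := q :* (P :* q̄)) refl P q′ (conj q′)) refl ⟩
        q′ * (P * conj q′) + q′ * t
          ≈⟨ distribˡ q′ _ _ ⟨
        q′ * (P * conj q′ + t)
          ≈⟨ *-congˡ (-‿inverseʳ _) ⟩
        q′ * 0#
          ≈⟨ zeroʳ q′ ⟩
        0# ∎

    -- Induction on the number of variables. Fixing the first one at an admissible value keeps the
    -- polynomial zero-free in the others, and `D` exceeds `D` of this restriction exactly by `r`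
    -- times the slope in the first variable.
    NonNeg-D : ∀ {ks} (p : Poly ks) → NonVanishing p → ∀ w → Domain w →
               NonNeg (c * (value p w * conj (value (D p) w)))
    NonNeg-D (const p) p≉0 [] w∈ =
      NonNeg-0 (trans (*-congˡ (trans (*-congˡ conj-0) (zeroʳ p))) (zeroʳ c))
    NonNeg-D {k ∷ ks} (p +X· q) pq≉0 ((r , z) ∷ w) (rz∈ , w∈) = NonNeg-resp eq
      (NonNeg-+ (NonNeg-D (combine r z p q) comb≉0 w w∈)
        (NonNeg-scale r>0 (NonNeg-slope k p q pq≉0 r z w (rz∈ , w∈))))
      where
      r>0 : PosReal r
      r>0 = admissible-scale k rz∈
      P = r * value p w + z * value q w
      Q = r * value (D p) w + z * value (D q) w
      q′ = value q w
      comb≉0 : NonVanishing (combine r z p q)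
      comb≉0 v v∈ comb≈0 = pq≉0 ((r , z) ∷ v) (rz∈ , v∈) (trans (sym (value-combine r z p q v)) comb≈0)
      eq : c * (value (combine r z p q) w * conj (value (D (combine r z p q)) w)) +
             r * (c * (P * conj q′)) ≈
           c * (P * conj (value (D {k ∷ ks} (p +X· q)) ((r , z) ∷ w)))
      eq = begin
        c * (value (combine r z p q) w * conj (value (D (combine r z p q)) w)) + r * (c * (P * conj q′))
          ≈⟨ +-congʳ (*-congˡ (*-cong (value-combine r z p q w) (conj-cong (value-D-combine r z p q w)))) ⟩
        c * (P * conj Q) + r * (c * (P * conj q′))
          ≈⟨ solve 5 (λ c P Q̄ r q̄ → c :* (P :* Q̄) :+ r :* (c :* (P :* q̄)) := c :* (P :* (Q̄ :+ r :* q̄))) refl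
               c P (conj Q) r (conj q′) ⟩
        c * (P * (conj Q + r * conj q′))
          ≈⟨ *-congˡ (*-congˡ (+-congˡ (*-congʳ (PosReal⇒conj r>0)))) ⟨
        c * (P * (conj Q + conj r * conj q′))
          ≈⟨ *-congˡ (*-congˡ (+-congˡ (conj-* r q′))) ⟨
        c * (P * (conj Q + conj (r * q′)))
          ≈⟨ *-congˡ (*-congˡ (conj-+ Q (r * q′))) ⟨
        c * (P * conj (Q + r * q′))
          ≈⟨ *-congˡ (*-congˡ (conj-cong (value-D {k} p q r z w))) ⟨
        c * (P * conj (value (D {k ∷ ks} (p +X· q)) ((r , z) ∷ w))) ∎

    -- With m and r the scales of x and y, and P and Q the values of p and D p, the value of
    -- T p is V = m y P + x (r P + y Q), and
    -- c x y P V̄ = m |P|²|y|² (c x) + r |P|²|x|² (c y) + |x|²|y|² (c P Q̄).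
    NonVanishing-T : ∀ {ks} (p : Poly ks) → NonVanishing p → NonVanishing {closed ∷ opened ∷ ks} (T p)
    NonVanishing-T {ks} p p≉0 ((m , x) ∷ (r , y) ∷ w) ((m>0 , x≥0) , (r>0 , y>0) , w∈) V≈0 =
      ¬≈0⇒norm x≉0 λ |x|²>0 → ¬≈0⇒norm y≉0 λ |y|²>0 → ¬≈0⇒norm P≉0 λ |P|²>0 →
      ¬Upper-0 (Upper-resp (begin
          r * (P * P̄ * (x * x̄)) * (c * y) +
            (m * (P * P̄ * (y * ȳ)) * (c * x) + x * x̄ * (y * ȳ) * (c * (P * Q̄)))
            ≈⟨ solve 10 (λ c x x̄ y ȳ P P̄ Q̄ m r →
                 r :* (P :* P̄ :* (x :* x̄)) :* (c :* y) :+
                   (m :* (P :* P̄ :* (y :* ȳ)) :* (c :* x) :+ x :* x̄ :* (y :* ȳ) :* (c :* (P :* Q̄))) :=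
                 c :* (x :* y :* P) :* (m :* (ȳ :* P̄) :+ x̄ :* (r :* P̄ :+ ȳ :* Q̄))) refl
                 c x x̄ y ȳ P P̄ Q̄ m r ⟩
          c * (x * y * P) * (m * (ȳ * P̄) + x̄ * (r * P̄ + ȳ * Q̄))
            ≈⟨ *-congˡ conj-V ⟨
          c * (x * y * P) * conj V
            ≈⟨ *-congˡ (trans (conj-cong V′≈0) conj-0) ⟩
          c * (x * y * P) * 0#
            ≈⟨ zeroʳ _ ⟩
          0# ∎)
        -- Only the term containing `c * y` is strict. It alone makes the imaginary part of zero
        -- positive, which is absurd.
        (Upper+NonNeg
          (Upper-scale (PosReal-* r>0 (PosReal-* |P|²>0 |x|²>0)) y>0)
          (NonNeg-+ (NonNeg-scale (PosReal-* m>0 (PosReal-* |P|²>0 |y|²>0)) x≥0)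
            (NonNeg-scale (PosReal-* |x|²>0 |y|²>0) (NonNeg-D p p≉0 w w∈)))))
      where
      P = value p w
      Q = value (D p) w
      x̄ = conj x
      ȳ = conj y
      P̄ = conj P
      Q̄ = conj Q
      V = m * (y * P) + x * (r * P + y * Q)
      V′≈0 : V ≈ 0#
      V′≈0 = trans (+-congʳ (*-congˡ (sym (trans
        (+-congʳ (trans (*-congˡ (value-zeroPoly w)) (zeroʳ r))) (+-identityˡ (y * P)))))) V≈0
      P≉0 : ¬ P ≈ 0#
      P≉0 = p≉0 w w∈
      y≉0 : ¬ y ≈ 0#
      y≉0 y≈0 = ¬Upper-0 (Upper-resp (trans (*-congˡ y≈0) (zeroʳ c)) y>0)
      -- The closed half plane contains zero, so this case is excluded directly: at `x = 0` only the
      -- nonzero term `m * (y * P)` survives in `V`.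
      x≉0 : ¬ x ≈ 0#
      x≉0 x≈0 = *-≉0 (¬PosReal-0 m>0) (*-≉0 y≉0 P≉0) (begin
        m * (y * P)                          ≈⟨ +-identityʳ _ ⟨
        m * (y * P) + 0#                     ≈⟨ +-congˡ (zeroˡ _) ⟨
        m * (y * P) + 0# * (r * P + y * Q)   ≈⟨ +-congˡ (*-congʳ x≈0) ⟨
        V                                    ≈⟨ V′≈0 ⟩
        0#                                   ∎)
      conj-V : conj V ≈ m * (ȳ * P̄) + x̄ * (r * P̄ + ȳ * Q̄)
      conj-V = begin
        conj V
          ≈⟨ conj-+ _ _ ⟩
        conj (m * (y * P)) + conj (x * (r * P + y * Q))
          ≈⟨ +-cong (trans (conj-* m _) (*-cong (PosReal⇒conj m>0) (conj-* y P)))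
               (trans (conj-* x _) (*-congˡ (trans (conj-+ _ _)
                 (+-cong (trans (conj-* r P) (*-congʳ (PosReal⇒conj r>0))) (conj-* y Q))))) ⟩
        m * (ȳ * P̄) + x̄ * (r * P̄ + ȳ * Q̄) ∎

-- Series along the diagonal shift

-- Hurwitz series: f : ℕ → R stands for Σ f n sⁿ/n!, so that differentiation is a shift.
module Hurwitz (R : CommutativeSemiring 0ℓ 0ℓ) where
  open CommutativeSemiring R hiding (zero)
  open SemiringSolver R using (solve; _:=_; _:+_; _:*_)

  Series : Set
  Series = ℕ → Carrier

  infix 4 _≈ˢ_
  _≈ˢ_ : Series → Series → Set
  f ≈ˢ g = ∀ n → f n ≈ g n

  ∂ : Series → Series
  ∂ f = f ∘ suc

  infixl 6 _+ˢ_
  infixl 7 _*ˢ_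

  -- The Leibniz rule serves as the definition of the product. Hence `∂` is a derivation by
  -- computation, and the binomial coefficients stay implicit.
  _+ˢ_ _*ˢ_ : Series → Series → Series
  (f +ˢ g) n       = f n + g n
  (f *ˢ g) zero    = f zero * g zero
  (f *ˢ g) (suc n) = (∂ f *ˢ g) n + (f *ˢ ∂ g) n

  constant : Carrier → Series
  constant a zero    = a
  constant a (suc n) = 0#

  0ˢ 1ˢ : Series
  0ˢ _ = 0#
  1ˢ   = constant 1#

  -- the series of a + s
  shifted : Carrier → Series
  shifted a zero    = a
  shifted a (suc n) = 1ˢ n

  *ˢ-cong : ∀ {f f′ g g′} → f ≈ˢ f′ → g ≈ˢ g′ → f *ˢ g ≈ˢ f′ *ˢ g′
  *ˢ-cong f≈ g≈ zero    = *-cong (f≈ zero) (g≈ zero)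
  *ˢ-cong f≈ g≈ (suc n) = +-cong (*ˢ-cong (f≈ ∘ suc) g≈ n) (*ˢ-cong f≈ (g≈ ∘ suc) n)

  *ˢ-comm : ∀ f g → f *ˢ g ≈ˢ g *ˢ f
  *ˢ-comm f g zero    = *-comm (f zero) (g zero)
  *ˢ-comm f g (suc n) = trans (+-cong (*ˢ-comm (∂ f) g n) (*ˢ-comm f (∂ g) n)) (+-comm _ _)

  *ˢ-distribʳ : ∀ f g h → (g +ˢ h) *ˢ f ≈ˢ g *ˢ f +ˢ h *ˢ f
  *ˢ-distribʳ f g h zero    = distribʳ (f zero) (g zero) (h zero)
  *ˢ-distribʳ f g h (suc n) =
    trans (+-cong (*ˢ-distribʳ f (∂ g) (∂ h) n) (*ˢ-distribʳ (∂ f) g h n))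
      (solve 4 (λ a b c d → (a :+ b) :+ (c :+ d) := (a :+ c) :+ (b :+ d)) refl
        ((∂ g *ˢ f) n) ((∂ h *ˢ f) n) ((g *ˢ ∂ f) n) ((h *ˢ ∂ f) n))

  *ˢ-distribˡ : ∀ f g h → f *ˢ (g +ˢ h) ≈ˢ f *ˢ g +ˢ f *ˢ h
  *ˢ-distribˡ f g h n = trans (*ˢ-comm f (g +ˢ h) n)
    (trans (*ˢ-distribʳ f g h n) (+-cong (*ˢ-comm g f n) (*ˢ-comm h f n)))

  *ˢ-assoc : ∀ f g h → (f *ˢ g) *ˢ h ≈ˢ f *ˢ (g *ˢ h)
  *ˢ-assoc f g h zero    = *-assoc (f zero) (g zero) (h zero)
  *ˢ-assoc f g h (suc n) = begin
    ((∂ f *ˢ g +ˢ f *ˢ ∂ g) *ˢ h) n + ((f *ˢ g) *ˢ ∂ h) n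
      ≈⟨ +-congʳ (*ˢ-distribʳ h (∂ f *ˢ g) (f *ˢ ∂ g) n) ⟩
    ((∂ f *ˢ g) *ˢ h) n + ((f *ˢ ∂ g) *ˢ h) n + ((f *ˢ g) *ˢ ∂ h) n
      ≈⟨ +-cong (+-cong (*ˢ-assoc (∂ f) g h n) (*ˢ-assoc f (∂ g) h n)) (*ˢ-assoc f g (∂ h) n) ⟩
    (∂ f *ˢ (g *ˢ h)) n + (f *ˢ (∂ g *ˢ h)) n + (f *ˢ (g *ˢ ∂ h)) n
      ≈⟨ +-assoc _ _ _ ⟩
    (∂ f *ˢ (g *ˢ h)) n + ((f *ˢ (∂ g *ˢ h)) n + (f *ˢ (g *ˢ ∂ h)) n)
      ≈⟨ +-congˡ (*ˢ-distribˡ f (∂ g *ˢ h) (g *ˢ ∂ h) n) ⟨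
    (∂ f *ˢ (g *ˢ h)) n + (f *ˢ (∂ g *ˢ h +ˢ g *ˢ ∂ h)) n ∎
    where open SetoidReasoning setoid

  *ˢ-zeroˡ : ∀ f → 0ˢ *ˢ f ≈ˢ 0ˢ
  *ˢ-zeroˡ f zero    = zeroˡ (f zero)
  *ˢ-zeroˡ f (suc n) = trans (+-cong (*ˢ-zeroˡ f n) (*ˢ-zeroˡ (∂ f) n)) (+-identityˡ 0#)

  *ˢ-identityˡ : ∀ f → 1ˢ *ˢ f ≈ˢ f
  *ˢ-identityˡ f zero    = *-identityˡ (f zero)
  *ˢ-identityˡ f (suc n) =
    trans (+-cong (*ˢ-zeroˡ f n) (*ˢ-identityˡ (∂ f) n)) (+-identityˡ (f (suc n)))

  commutativeSemiringˢ : CommutativeSemiring 0ℓ 0ℓ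
  commutativeSemiringˢ = record
    { isCommutativeSemiring = IsCommutativeSemiringˡ.isCommutativeSemiring record
      { +-isCommutativeMonoid = record
        { isMonoid = record
          { isSemigroup = record
            { isMagma = record
              { isEquivalence = isEquivalenceˢ
              ; ∙-cong = λ p q n → +-cong (p n) (q n)
              }
            ; assoc = λ f g h n → +-assoc (f n) (g n) (h n)
            }
          ; identity = (λ f n → +-identityˡ (f n)) , (λ f n → +-identityʳ (f n))
          }
        ; comm = λ f g n → +-comm (f n) (g n)
        }
      ; *-isCommutativeMonoid = record
        { isMonoid = record
          { isSemigroup = record
            { isMagma = record
              { isEquivalence = isEquivalenceˢ
              ; ∙-cong = *ˢ-cong
              }
            ; assoc = *ˢ-assoc
            }
          ; identity = *ˢ-identityˡ , λ f n → trans (*ˢ-comm f 1ˢ n) (*ˢ-identityˡ f n)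
          }
        ; comm = *ˢ-comm
        }
      ; distribʳ = *ˢ-distribʳ
      ; zeroˡ    = *ˢ-zeroˡ
      }
    }
    where
    isEquivalenceˢ : IsEquivalence _≈ˢ_
    isEquivalenceˢ = record
      { refl  = λ _ → refl
      ; sym   = λ p n → sym (p n)
      ; trans = λ p q n → trans (p n) (q n)
      }

-- Permutations by insertion of the largest letter, and the recursion for their weights

inserts : ℕ → List ℕ → List (List ℕ)
inserts k []      = (k ∷ []) ∷ []
inserts k (u ∷ σ) = (k ∷ u ∷ σ) ∷ map (u ∷_) (inserts k σ)

perms : ℕ → List (List ℕ)
perms zero    = [] ∷ []
perms (suc k) = concatMap (inserts k) (perms k)

inserts-↭ : ∀ k σ → All (_↭ k ∷ σ) (inserts k σ)
inserts-↭ k []      = ↭-refl ∷ []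
inserts-↭ k (u ∷ σ) = ↭-refl ∷
  All.map⁺ (All.map (λ p → ↭-trans (↭.prep u p) (↭.swap u k ↭-refl)) (inserts-↭ k σ))

perms-↭ : ∀ k → All (_↭ downFrom k) (perms k)
perms-↭ zero    = ↭-refl ∷ []
perms-↭ (suc k) = All.concat⁺ (All.map⁺
  (All.map (λ {σ} p → All.map (λ q → ↭-trans q (↭.prep k p)) (inserts-↭ k σ)) (perms-↭ k)))

downFrom-< : ∀ k → All (_< k) (downFrom k)
downFrom-< k = All.applyDownFrom⁺₁ (λ i → i) k (λ i<k → i<k)

module Fold (M : CommutativeMonoid 0ℓ 0ℓ) where
  open CommutativeMonoid M

  module _ {A : Set} where

    fold : (A → Carrier) → List A → Carrier
    fold f []       = ε
    fold f (a ∷ as) = f a ∙ fold f as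

    fold-cong : ∀ {f g : A → Carrier} {as} → All (λ a → f a ≈ g a) as → fold f as ≈ fold g as
    fold-cong []       = refl
    fold-cong (p ∷ ps) = ∙-cong p (fold-cong ps)

    fold-++ : ∀ (f : A → Carrier) as bs → fold f (as ++ bs) ≈ fold f as ∙ fold f bs
    fold-++ f []       bs = sym (identityˡ _)
    fold-++ f (a ∷ as) bs = trans (∙-congˡ (fold-++ f as bs)) (sym (assoc _ _ _))

    fold-↭ : ∀ (f : A → Carrier) {as bs} → as ↭ bs → fold f as ≈ fold f bs
    fold-↭ f ↭.refl         = refl
    fold-↭ f (↭.prep a p)   = ∙-congˡ (fold-↭ f p)
    fold-↭ f (↭.swap a b p) = trans (x∙yz≈y∙xz (f a) (f b) _) (∙-congˡ (∙-congˡ (fold-↭ f p)))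
      where open CommutativeSemigroupProperties commutativeSemigroup using (x∙yz≈y∙xz)
    fold-↭ f (↭.trans p q)  = trans (fold-↭ f p) (fold-↭ f q)

  module _ {A B : Set} where

    fold-map : ∀ (f : A → Carrier) (g : B → A) bs → fold f (map g bs) ≡ fold (f ∘ g) bs
    fold-map f g []       = ≡.refl
    fold-map f g (b ∷ bs) = ≡.cong (f (g b) ∙_) (fold-map f g bs)

    fold-concatMap : ∀ (f : A → Carrier) (g : B → List A) bs →
                     fold f (concatMap g bs) ≈ fold (fold f ∘ g) bs
    fold-concatMap f g []       = refl
    fold-concatMap f g (b ∷ bs) = trans (fold-++ f (g b) _) (∙-congˡ (fold-concatMap f g bs))

module Sums (R : CommutativeSemiring 0ℓ 0ℓ) where
  open CommutativeSemiring R
  open Fold +-commutativeMonoid public renaming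
    ( fold to Σ; fold-cong to Σ-cong; fold-++ to Σ-++; fold-↭ to Σ-↭
    ; fold-map to Σ-map; fold-concatMap to Σ-concatMap )

  Σ-*ˡ : ∀ {A : Set} c (f : A → Carrier) as → Σ (λ a → c * f a) as ≈ c * Σ f as
  Σ-*ˡ c f []       = sym (zeroʳ c)
  Σ-*ˡ c f (a ∷ as) = trans (+-congˡ (Σ-*ˡ c f as)) (sym (distribˡ c _ _))

module Words (R : CommutativeSemiring 0ℓ 0ℓ) (x y : ℕ → CommutativeSemiring.Carrier R) where
  open CommutativeSemiring R hiding (zero)
  open Sums R public

  -- An adjacent pair contributes the variable of its top, that is, of its larger letter.
  step : ℕ → ℕ → Carrier
  step u v = if v <ᵇ u then x u else y v

  weight : List ℕ → Carrier
  weight []          = 1#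
  weight (u ∷ [])    = 1#
  weight (u ∷ v ∷ σ) = step u v * weight (v ∷ σ)

  weight-sum : ℕ → Carrier
  weight-sum k = Σ weight (perms k)

  step-asc : ∀ {u v} → u < v → step u v ≡ y v
  step-asc {u} {v} u<v with v <ᵇ u in eq
  ... | false = ≡.refl
  ... | true  = contradiction (ℕ.<ᵇ⇒< v u (≡.subst Bool.T (≡.sym eq) _)) (ℕ.<-asym u<v)

  step-desc : ∀ {u v} → v < u → step u v ≡ x u
  step-desc {u} {v} v<u with v <ᵇ u in eq
  ... | true  = ≡.refl
  ... | false = contradiction (≡.subst Bool.T eq (ℕ.<⇒<ᵇ v<u)) λ ()

  -- The recursion holds for every derivation that sends all variables to 1; the sum of all partial
  -- derivatives is the model case.
  module Insertion
    (∂ : Carrier → Carrier)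
    (∂-cong : ∀ {f g} → f ≈ g → ∂ f ≈ ∂ g)
    (∂-+ : ∀ f g → ∂ (f + g) ≈ ∂ f + ∂ g)
    (∂-* : ∀ f g → ∂ (f * g) ≈ ∂ f * g + f * ∂ g)
    (∂-0 : ∂ 0# ≈ 0#) (∂-1 : ∂ 1# ≈ 0#)
    (∂-x : ∀ i → ∂ (x i) ≈ 1#) (∂-y : ∀ i → ∂ (y i) ≈ 1#)
    where
    open SetoidReasoning setoid
    open SemiringSolver R using (solve; _:=_; _:+_; _:*_; con)

    ∂-step : ∀ u v → ∂ (step u v) ≈ 1#
    ∂-step u v with v <ᵇ u
    ... | true  = ∂-x u
    ... | false = ∂-y v

    -- Inserting `k` into a gap replaces the factor of that gap by `y k * x k`: an ascent to `k`,
    -- then a descent from it. Since every factor has derivative 1, deleting each factor in turn and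
    -- summing is the product rule for `∂`. The position at the end adds an ascent only, whence the
    -- term `y k * weight (u ∷ σ)`.
    insert-after : ∀ k u σ → All (_< k) (u ∷ σ) →
      Σ (λ τ → weight (u ∷ τ)) (inserts k σ) ≈
      y k * weight (u ∷ σ) + x k * y k * ∂ (weight (u ∷ σ))
    insert-after k u [] (u<k ∷ _) = begin
      step u k * 1# + 0#                 ≡⟨ ≡.cong (λ a → a * 1# + 0#) (step-asc u<k) ⟩
      y k * 1# + 0#                      ≈⟨ +-congˡ (zeroʳ (x k * y k)) ⟨
      y k * 1# + x k * y k * 0#          ≈⟨ +-congˡ (*-congˡ ∂-1) ⟨
      y k * 1# + x k * y k * ∂ 1#        ∎
    insert-after k u (v ∷ σ) (u<k ∷ vσ<k@(v<k ∷ _)) = begin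
      step u k * (step k v * w) + Σ (λ τ → weight (u ∷ τ)) (map (v ∷_) (inserts k σ))
        ≡⟨ ≡.cong₂ _+_
             (≡.cong₂ (λ a b → a * (b * w)) (step-asc u<k) (step-desc v<k))
             (Σ-map (λ τ → weight (u ∷ τ)) (v ∷_) (inserts k σ)) ⟩
      y k * (x k * w) + Σ (λ τ → s * weight (v ∷ τ)) (inserts k σ)
        ≈⟨ +-congˡ (Σ-*ˡ s (λ τ → weight (v ∷ τ)) (inserts k σ)) ⟩
      y k * (x k * w) + s * Σ (λ τ → weight (v ∷ τ)) (inserts k σ)
        ≈⟨ +-congˡ (*-congˡ (insert-after k v σ vσ<k)) ⟩
      y k * (x k * w) + s * (y k * w + x k * y k * ∂ w)
        ≈⟨ solve 5 (λ x y s w w′ →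
             y :* (x :* w) :+ s :* (y :* w :+ x :* y :* w′) :=
             y :* (s :* w) :+ x :* y :* (con 1 :* w :+ s :* w′)) refl (x k) (y k) s w (∂ w) ⟩
      y k * (s * w) + x k * y k * (1# * w + s * ∂ w)
        ≈⟨ +-congˡ (*-congˡ (trans (∂-* s w) (+-congʳ (*-congʳ (∂-step u v))))) ⟨
      y k * (s * w) + x k * y k * ∂ (s * w) ∎
      where
      s = step u v
      w = weight (v ∷ σ)

    grow : ℕ → Carrier → Carrier
    grow k f = (x k + y k) * f + x k * y k * ∂ f

    grow-+ : ∀ k f g → grow k f + grow k g ≈ grow k (f + g)
    grow-+ k f g = trans
      (solve 6 (λ x y f g f′ g′ →
          ((x :+ y) :* f :+ x :* y :* f′) :+ ((x :+ y) :* g :+ x :* y :* g′) :=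
          (x :+ y) :* (f :+ g) :+ x :* y :* (f′ :+ g′)) refl (x k) (y k) f g (∂ f) (∂ g))
      (+-congˡ (*-congˡ (sym (∂-+ f g))))

    insert-anywhere : ∀ k u σ → All (_< k) (u ∷ σ) →
                      Σ weight (inserts k (u ∷ σ)) ≈ grow k (weight (u ∷ σ))
    insert-anywhere k u σ uσ<k@(u<k ∷ _) = begin
      -- The front position, missing from `insert-after`, begins with a descent from `k` and
      -- provides the factor `x k`.
      step k u * w + Σ weight (map (u ∷_) (inserts k σ))
        ≡⟨ ≡.cong₂ (λ a b → a * w + b) (step-desc u<k) (Σ-map weight (u ∷_) (inserts k σ)) ⟩
      x k * w + Σ (λ τ → weight (u ∷ τ)) (inserts k σ)
        ≈⟨ +-congˡ (insert-after k u σ uσ<k) ⟩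
      x k * w + (y k * w + x k * y k * ∂ w)
        ≈⟨ solve 4 (λ x y w w′ → x :* w :+ (y :* w :+ x :* y :* w′) := (x :+ y) :* w :+ x :* y :* w′) refl
             (x k) (y k) w (∂ w) ⟩
      grow k w ∎
      where w = weight (u ∷ σ)

    grow-0 : ∀ k → grow k 0# ≈ 0#
    grow-0 k = trans (+-cong (zeroʳ _) (trans (*-congˡ ∂-0) (zeroʳ _))) (+-identityˡ 0#)

    Σ-grow : ∀ k {A : Set} (f : A → Carrier) as → Σ (grow k ∘ f) as ≈ grow k (Σ f as)
    Σ-grow k f []       = sym (grow-0 k)
    Σ-grow k f (a ∷ as) = trans (+-congˡ (Σ-grow k f as)) (grow-+ k (f a) (Σ f as))

    -- The recursion starts from one letter: insertion into the empty word creates no adjacent pair,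
    -- and `grow` would give a wrong value there.
    weight-sum-suc : ∀ n → weight-sum (suc (suc n)) ≈ grow (suc n) (weight-sum (suc n))
    weight-sum-suc n = begin
      Σ weight (concatMap (inserts (suc n)) (perms (suc n)))
        ≈⟨ Σ-concatMap weight (inserts (suc n)) (perms (suc n)) ⟩
      Σ (Σ weight ∘ inserts (suc n)) (perms (suc n))
        ≈⟨ Σ-cong (All.map (λ {σ} → insert σ) (perms-↭ (suc n))) ⟩
      Σ (grow (suc n) ∘ weight) (perms (suc n))
        ≈⟨ Σ-grow (suc n) weight (perms (suc n)) ⟩
      grow (suc n) (weight-sum (suc n)) ∎
      where
      insert : ∀ σ → σ ↭ downFrom (suc n) → Σ weight (inserts (suc n) σ) ≈ grow (suc n) (weight σ)
      insert []      p = contradiction (↭P.↭-length p) λ ()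
      insert (u ∷ σ) p = insert-anywhere (suc n) u σ (↭P.All-resp-↭ (↭-sym p) (downFrom-< (suc n)))

-- Matching the operator `T` with the insertion recursion

kinds : ℕ → List Kind
kinds zero    = []
kinds (suc n) = closed ∷ opened ∷ kinds n

module Eulerian (R : CommutativeRing 0ℓ 0ℓ) (H : HalfPlane R)
  (x y : ℕ → CommutativeRing.Carrier R) where

  open CommutativeRing R hiding (zero)
  open HalfPlane H
  open Stable R H
  open Hurwitz commutativeSemiring
  private
    module S = CommutativeSemiring commutativeSemiringˢ
  module V = Words commutativeSemiring x y
  module W = Words commutativeSemiringˢ (shifted ∘ x) (shifted ∘ y)

  Values : List Kind → Set
  Values = All (λ _ → Carrier)

  -- The value at `w` moved by s in every coordinate, as a series in s. By the chain rule its
  -- derivative is the value of the sum of all partial derivatives, which links `D` to `∂`.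
  expand : ∀ {ks} → Poly ks → Values ks → Series
  expand (const a)  []      = constant a
  expand (p +X· q) (z ∷ w) = expand p w +ˢ shifted z *ˢ expand q w

  expand-⊞ : ∀ {ks} (p q : Poly ks) w → expand (p ⊞ q) w ≈ˢ expand p w +ˢ expand q w
  expand-⊞ (const a) (const b) [] zero    = refl
  expand-⊞ (const a) (const b) [] (suc n) = sym (+-identityʳ 0#)
  expand-⊞ (p₀ +X· p₁) (q₀ +X· q₁) (z ∷ w) = S.trans
    (S.+-cong (expand-⊞ p₀ q₀ w) (S.*-congˡ {shifted z} (expand-⊞ p₁ q₁ w)))
    (solve 5 (λ z a b c d → (a :+ c) :+ z :* (b :+ d) := (a :+ z :* b) :+ (c :+ z :* d)) S.refl
      (shifted z) (expand p₀ w) (expand p₁ w) (expand q₀ w) (expand q₁ w))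
    where open SemiringSolver commutativeSemiringˢ using (solve; _:=_; _:+_; _:*_)

  expand-zeroPoly : ∀ {ks} w → expand (zeroPoly {ks}) w ≈ˢ 0ˢ
  expand-zeroPoly {[]} [] zero    = refl
  expand-zeroPoly {[]} [] (suc n) = refl
  expand-zeroPoly {_ ∷ _} (z ∷ w) = S.trans
    (S.+-cong (expand-zeroPoly w)
      (S.trans (S.*-congˡ {shifted z} (expand-zeroPoly w)) (S.zeroʳ (shifted z))))
    (S.+-identityʳ 0ˢ)

  ∂-expand : ∀ {ks} (p : Poly ks) w → ∂ (expand p w) ≈ˢ expand (D p) w
  ∂-expand (const a) [] zero    = refl
  ∂-expand (const a) [] (suc n) = refl
  ∂-expand (p +X· q) (z ∷ w) = begin
    ∂ (expand p w) +ˢ (1ˢ *ˢ expand q w +ˢ shifted z *ˢ ∂ (expand q w))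
      ≈⟨ S.+-cong (∂-expand p w) (S.+-cong (S.*-identityˡ (expand q w)) (S.*-congˡ {shifted z} (∂-expand q w))) ⟩
    expand (D p) w +ˢ (expand q w +ˢ shifted z *ˢ expand (D q) w)
      ≈⟨ S.+-assoc (expand (D p) w) (expand q w) (shifted z *ˢ expand (D q) w) ⟨
    expand (D p) w +ˢ expand q w +ˢ shifted z *ˢ expand (D q) w
      ≈⟨ S.+-congʳ (S.sym (expand-⊞ (D p) q w)) ⟩
    expand (D p ⊞ q) w +ˢ shifted z *ˢ expand (D q) w ∎
    where open SetoidReasoning S.setoid

  unscaled : ∀ {ks} → Values ks → Coordinates ks
  unscaled = All.map (1# ,_)

  expand-0 : ∀ {ks} (p : Poly ks) w → expand p w 0 ≈ value p (unscaled w)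
  expand-0 (const a) [] = refl
  expand-0 (p +X· q) (z ∷ w) =
    +-cong (trans (expand-0 p w) (sym (*-identityˡ _))) (*-congˡ (expand-0 q w))

  eulerian : ∀ n → Poly (kinds n)
  eulerian zero    = const 1#
  eulerian (suc n) = T (eulerian n)

  values : ∀ n → Values (kinds n)
  values zero    = []
  values (suc n) = x (suc n) ∷ y (suc n) ∷ values n

  open W.Insertion ∂ (λ f≈g → f≈g ∘ suc) (λ _ _ → S.refl) (λ _ _ → S.refl)
    (λ _ → refl) (λ _ → refl) (λ _ _ → refl) (λ _ _ → refl)

  -- Equality of constant terms would not carry the induction: the recursion differentiates, so each
  -- step uses the hypothesis one coefficient higher. The claim therefore concerns whole series.
  expand-eulerian : ∀ n → expand (eulerian n) (values n) ≈ˢ W.weight-sum (suc n)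
  expand-eulerian zero    = S.sym (S.+-identityʳ 1ˢ)
  expand-eulerian (suc n) = begin
    (expand zeroPoly w +ˢ Y *ˢ f) +ˢ X *ˢ (f +ˢ Y *ˢ expand (D (eulerian n)) w)
      ≈⟨ S.+-cong (S.+-congʳ (expand-zeroPoly w))
           (S.*-congˡ {X} (S.+-congˡ {f} (S.*-congˡ {Y} (S.sym (∂-expand (eulerian n) w))))) ⟩
    (0ˢ +ˢ Y *ˢ f) +ˢ X *ˢ (f +ˢ Y *ˢ ∂ f)
      ≈⟨ solve 4 (λ X Y f f′ → (con 0 :+ Y :* f) :+ X :* (f :+ Y :* f′) := (X :+ Y) :* f :+ X :* Y :* f′)
           S.refl X Y f (∂ f) ⟩
    grow (suc n) f
      ≈⟨ S.+-cong (S.*-congˡ {X +ˢ Y} (expand-eulerian n)) (S.*-congˡ {X *ˢ Y} (expand-eulerian n ∘ suc)) ⟩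
    grow (suc n) (W.weight-sum (suc n))
      ≈⟨ weight-sum-suc n ⟨
    W.weight-sum (suc (suc n)) ∎
    where
    open SetoidReasoning S.setoid
    open SemiringSolver commutativeSemiringˢ using (solve; _:=_; _:+_; _:*_; con)
    w = values n
    f = expand (eulerian n) w
    X = shifted (x (suc n))
    Y = shifted (y (suc n))

  weight-0 : ∀ σ → W.weight σ 0 ≈ V.weight σ
  weight-0 []          = refl
  weight-0 (u ∷ [])    = refl
  weight-0 (u ∷ v ∷ σ) = *-cong step-0 (weight-0 (v ∷ σ))
    where
    step-0 : W.step u v 0 ≈ V.step u v
    step-0 with v <ᵇ u
    ... | true  = refl
    ... | false = refl

  Σ-weight-0 : ∀ σs → W.Σ W.weight σs 0 ≈ V.Σ V.weight σs
  Σ-weight-0 []       = refl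
  Σ-weight-0 (σ ∷ σs) = +-cong (weight-0 σ) (Σ-weight-0 σs)

  weight-sum≉0 : ∀ c → (∀ i → NonNeg (c * x i)) → (∀ i → Upper (c * y i)) →
                 ∀ n → ¬ V.weight-sum (suc n) ≈ 0#
  weight-sum≉0 c x≥0 y>0 n sum≈0 = eulerian≉0 n (unscaled (values n)) (values∈ n)
    (trans (sym (expand-0 (eulerian n) (values n)))
      (trans (expand-eulerian n 0) (trans (Σ-weight-0 (perms (suc n))) sum≈0)))
    where
    open Rotated c
    eulerian≉0 : ∀ n → NonVanishing (eulerian n)
    eulerian≉0 zero    [] _ = ¬PosReal-0 PosReal-1
    eulerian≉0 (suc n)      = NonVanishing-T (eulerian n) (eulerian≉0 n)
    values∈ : ∀ n → Domain (unscaled (values n))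
    values∈ zero    = tt
    values∈ (suc n) = (PosReal-1 , x≥0 (suc n)) , (PosReal-1 , y>0 (suc n)) , values∈ n

-- Insertion words and the symmetric group list the same permutations

module Enumeration where
  open ≡ using (refl; sym; trans; cong; cong₂; subst)

  unique∧⊆∧⊇⇒↭ : ∀ {A : Set} {xs ys : List A} → Unique xs → Unique ys →
                  (∀ {a} → a ∈ xs → a ∈ ys) → (∀ {a} → a ∈ ys → a ∈ xs) → xs ↭ ys
  unique∧⊆∧⊇⇒↭ xs! ys! xs⊆ys ys⊆xs = ∼bag⇒↭ (unique∧set⇒bag xs! ys! (mk⇔ xs⊆ys ys⊆xs))

  -- `g` recovers from every entry the block it comes from, so blocks of distinct elements are
  -- disjoint.
  Unique-concatMap : ∀ {A B : Set} (f : A → List B) (g : B → A) {as} →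
    All (λ a → Unique (f a) × All (λ b → g b ≡ a) (f a)) as → Unique as → Unique (concatMap f as)
  Unique-concatMap f g [] [] = []
  Unique-concatMap f g {a ∷ as} ((fa! , gf) ∷ rest) as!@(_ ∷ as′!) =
    Unique.++⁺ fa! (Unique-concatMap f g rest as′!) λ (b∈fa , b∈rest) →
      Unique.Unique[x∷xs]⇒x∉xs as! (subst (_∈ as) (All.lookup gf b∈fa) (origin rest b∈rest))
    where
    origin : ∀ {b as} → All (λ a → Unique (f a) × All (λ b → g b ≡ a) (f a)) as →
             b ∈ concatMap f as → g b ∈ as
    origin {b} {as = a ∷ as} ((_ , gf) ∷ rest) b∈ with ∈.∈-++⁻ (f a) b∈
    ... | inj₁ b∈fa = here (All.lookup gf b∈fa)
    ... | inj₂ b∈as = there (origin rest b∈as)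

  without : ℕ → List ℕ → List ℕ
  without k = filter (¬? ∘ (k ℕ.≟_))

  without-inserts : ∀ k σ → All (k ≢_) σ → All (λ τ → without k τ ≡ σ) (inserts k σ)
  without-inserts k [] [] = List.filter-reject (¬? ∘ (k ℕ.≟_)) (λ k≢k → k≢k refl) ∷ []
  without-inserts k (u ∷ σ) k≢@(k≢u ∷ k≢σ) =
    trans (List.filter-reject k≢? (λ k≢k → k≢k refl)) (List.filter-all k≢? k≢) ∷
    All.map⁺ (All.map (λ eq → trans (List.filter-accept k≢? k≢u) (cong (u ∷_) eq))
      (without-inserts k σ k≢σ))
    where k≢? = ¬? ∘ (k ℕ.≟_)

  inserts-unique : ∀ k σ → All (k ≢_) σ → Unique (inserts k σ)
  inserts-unique k []      []          = [] ∷ []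
  inserts-unique k (u ∷ σ) (k≢u ∷ k≢σ) =
    All.map⁺ (All.tabulate λ _ eq → k≢u (List.∷-injectiveˡ eq)) ∷
    Unique.map⁺ List.∷-injectiveʳ (inserts-unique k σ k≢σ)

  ↭downFrom⇒< : ∀ {k σ} → σ ↭ downFrom k → All (_< k) σ
  ↭downFrom⇒< {k} σ↭ = ↭P.All-resp-↭ (↭-sym σ↭) (downFrom-< k)

  perms-unique : ∀ k → Unique (perms k)
  perms-unique zero    = [] ∷ []
  perms-unique (suc k) = Unique-concatMap (inserts k) (without k)
    (All.map (λ {σ} σ↭ → let k≢σ = All.map (λ u<k k≡u → ℕ.<⇒≢ u<k (sym k≡u)) (↭downFrom⇒< σ↭)
                         in inserts-unique k σ k≢σ , without-inserts k σ k≢σ) (perms-↭ k))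
    (perms-unique k)

  ∈-inserts : ∀ k xs ys → xs ++ k ∷ ys ∈ inserts k (xs ++ ys)
  ∈-inserts k []       []       = here refl
  ∈-inserts k []       (y ∷ ys) = here refl
  ∈-inserts k (x ∷ xs) ys       = there (∈.∈-map⁺ (x ∷_) (∈-inserts k xs ys))

  -- Deleting the largest letter leaves an arrangement of the smaller ones, and inserting it again
  -- at the same place restores the word.
  ↭downFrom⇒∈perms : ∀ k {σ} → σ ↭ downFrom k → σ ∈ perms k
  ↭downFrom⇒∈perms zero    σ↭ = here (↭P.↭-empty-inv σ↭)
  ↭downFrom⇒∈perms (suc k) σ↭ with ∈.∈-∃++ (↭P.∈-resp-↭ (↭-sym σ↭) (here refl))
  ... | xs , ys , refl = ∈.∈-concatMap⁺ (inserts k)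
    (Any.map (λ { refl → ∈-inserts k xs ys })
      (↭downFrom⇒∈perms k (↭P.drop-mid xs [] σ↭)))

  Unique-resp-↭ : ∀ {xs ys : List ℕ} → xs ↭ ys → Unique xs → Unique ys
  Unique-resp-↭ p = SP.Unique-resp-↭ (↭.↭⇒↭ₛ p)
    where import Data.List.Relation.Binary.Permutation.Setoid.Properties (≡.setoid ℕ) as SP

  <∧≢⇒All< : ∀ {k σ} → All (_< suc k) σ → All (k ≢_) σ → All (_< k) σ
  <∧≢⇒All< σ<1+k k≢σ =
    All.zipWith (λ (u<1+k , k≢u) → ℕ.≤∧≢⇒< (ℕ.<⇒≤pred u<1+k) (k≢u ∘ sym)) (σ<1+k , k≢σ)

  -- A pigeonhole argument by induction. If `k` did not occur, the tail alone would exhaust all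
  -- letters below `k` and so repeat the first letter. Hence `k` occurs, and it can be removed.
  unique⇒↭downFrom : ∀ k σ → Unique σ → length σ ≡ k → All (_< k) σ → σ ↭ downFrom k
  unique⇒↭downFrom zero    [] _  _  _ = ↭-refl
  unique⇒↭downFrom (suc k) σ  σ! eq σ<1+k with Any.any? (k ℕ.≟_) σ
  ... | no k∉σ = contradiction (All.¬Any⇒All¬ σ k∉σ) (k-occurs σ σ! eq σ<1+k)
    where
    k-occurs : ∀ σ → Unique σ → length σ ≡ suc k → All (_< suc k) σ → ¬ All (k ≢_) σ
    k-occurs (u ∷ τ) uτ!@(_ ∷ τ!) eq uτ<1+k k≢uτ
      with u<k ∷ τ<k ← <∧≢⇒All< uτ<1+k k≢uτ =
      Unique.Unique[x∷xs]⇒x∉xs uτ! (↭P.∈-resp-↭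
        (↭-sym (unique⇒↭downFrom k τ τ! (ℕ.suc-injective eq) τ<k)) (∈.∈-downFrom⁺ u<k))
  ... | yes k∈σ with xs , ys , refl ← ∈.∈-∃++ k∈σ
      with k≢ ∷ τ! ← Unique-resp-↭ (↭P.shift k xs ys) σ!
      with _ ∷ τ<1+k ← ↭P.All-resp-↭ (↭P.shift k xs ys) σ<1+k
    = ↭-trans (↭P.shift k xs ys) (↭.prep k (unique⇒↭downFrom k (xs ++ ys) τ!
        (ℕ.suc-injective (trans (sym (↭P.↭-length (↭P.shift k xs ys))) eq)) (<∧≢⇒All< τ<1+k k≢)))

  letters : ∀ {k m} → Vec (Fin k) m → List ℕ
  letters []      = []
  letters (u ∷ σ) = toℕ u ∷ letters σ

  letters-injective : ∀ {k m} {σ τ : Vec (Fin k) m} → letters σ ≡ letters τ → σ ≡ τ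
  letters-injective {σ = []}    {[]}    _  = refl
  letters-injective {σ = u ∷ σ} {v ∷ τ} eq =
    cong₂ _∷_ (Fin.toℕ-injective (List.∷-injectiveˡ eq)) (letters-injective (List.∷-injectiveʳ eq))

  letters-length : ∀ {k m} (σ : Vec (Fin k) m) → length (letters σ) ≡ m
  letters-length []      = refl
  letters-length (u ∷ σ) = cong suc (letters-length σ)

  letters-< : ∀ {k m} (σ : Vec (Fin k) m) → All (_< k) (letters σ)
  letters-< []      = []
  letters-< (u ∷ σ) = Fin.toℕ<n u ∷ letters-< σ

  letters-surjective : ∀ {k} m σ → length σ ≡ m → All (_< k) σ → ∃[ τ ] letters {k} {m} τ ≡ σ
  letters-surjective zero    []      _  _           = [] , refl
  letters-surjective (suc m) (u ∷ σ) eq (u<k ∷ σ<k)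
    with τ , refl ← letters-surjective m σ (ℕ.suc-injective eq) σ<k =
    fromℕ< u<k ∷ τ , cong (_∷ letters τ) (Fin.toℕ-fromℕ< u<k)

  letters-unique⁺ : ∀ {k m} {σ : Vec (Fin k) m} → Vec.Unique σ → Unique (letters σ)
  letters-unique⁺ []         = []
  letters-unique⁺ (u∉σ ∷ σ!) = all u∉σ ∷ letters-unique⁺ σ!
    where
    all : ∀ {k m u} {σ : Vec (Fin k) m} → VecAll.All (u ≢_) σ → All (toℕ u ≢_) (letters σ)
    all []        = []
    all (u≢ ∷ u∉) = u≢ ∘ Fin.toℕ-injective ∷ all u∉

  letters-unique⁻ : ∀ {k m} {σ : Vec (Fin k) m} → Unique (letters σ) → Vec.Unique σ
  letters-unique⁻ {σ = []}    []         = []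
  letters-unique⁻ {σ = u ∷ σ} (u∉σ ∷ σ!) = all σ u∉σ ∷ letters-unique⁻ σ!
    where
    all : ∀ {k m u} (σ : Vec (Fin k) m) → All (toℕ u ≢_) (letters σ) → VecAll.All (u ≢_) σ
    all []      []        = []
    all (v ∷ σ) (u≢ ∷ u∉) = u≢ ∘ cong toℕ ∷ all σ u∉

  words-unique : ∀ k m → Unique (words k m)
  words-unique k zero    = [] ∷ []
  words-unique k (suc m) =
    Unique.cartesianProductWith⁺ _∷_ Vec.∷-injective (Unique.allFin⁺ k) (words-unique k m)

  ∈-words : ∀ {k m} (σ : Vec (Fin k) m) → σ ∈ words k m
  ∈-words []      = here refl
  ∈-words (u ∷ σ) = ∈.∈-cartesianProductWith⁺ _∷_ (∈.∈-allFin u) (∈-words σ)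

  unique? : ∀ {k m} (σ : Vec (Fin k) m) → Dec (Vec.Unique σ)
  unique? = VecAllPairs.allPairs? (λ u v → ¬? (u Fin.≟ v))

  ∈-𝔖⁻ : ∀ {k σ} → σ ∈ 𝔖 k → Vec.Unique σ
  ∈-𝔖⁻ {k} = proj₂ ∘ ∈.∈-filter⁻ unique? {xs = words k k}

  -- The two enumerations differ in order, which a sum does not see. As both are free of
  -- repetitions, it suffices to compare their entries.
  letters-𝔖-↭-perms : ∀ k → map letters (𝔖 k) ↭ perms k
  letters-𝔖-↭-perms k = unique∧⊆∧⊇⇒↭
    (Unique.map⁺ letters-injective (Unique.filter⁺ unique? (words-unique k k)))
    (perms-unique k)
    to from
    where
    to : ∀ {σ} → σ ∈ map letters (𝔖 k) → σ ∈ perms k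
    to σ∈ with τ , τ∈ , refl ← ∈.∈-map⁻ letters σ∈ = ↭downFrom⇒∈perms k
      (unique⇒↭downFrom k (letters τ) (letters-unique⁺ (∈-𝔖⁻ τ∈)) (letters-length τ) (letters-< τ))
    from : ∀ {σ} → σ ∈ perms k → σ ∈ map letters (𝔖 k)
    from {σ} σ∈
      with σ↭ ← All.lookup (perms-↭ k) σ∈
      with τ , refl ← letters-surjective k σ
        (trans (↭P.↭-length σ↭) (List.length-downFrom k)) (↭downFrom⇒< σ↭) =
      ∈.∈-map⁺ letters (∈.∈-filter⁺ unique? (∈-words τ)
        (letters-unique⁻ (Unique-resp-↭ (↭-sym σ↭) downFrom!)))
      where
      downFrom! : Unique (downFrom k)
      downFrom! = Unique.downFrom⁺ k

open Enumeration

-- Descent top monomials as weights of words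

descentTops : ∀ {k m} → Vec (Fin k) (suc m) → List (Fin k)
descentTops (u ∷ []) = []
descentTops (u ∷ v ∷ σ) with v Fin.<? u
... | yes _ = u ∷ descentTops (v ∷ σ)
... | no  _ = descentTops (v ∷ σ)

-- `DescentTop` with the size of the alphabet separated from the length of the word, so that
-- induction can pass to the tail.
IsDescentTop : ∀ {k m} → Vec (Fin k) (suc m) → Fin k → Set
IsDescentTop σ t = ∃[ i ] (lookup σ (inject₁ i) Fin.> lookup σ (suc i) × t ≡ lookup σ (inject₁ i))

∈-descentTops⁺ : ∀ {k m} (σ : Vec (Fin k) (suc m)) {t} → IsDescentTop σ t → t ∈ descentTops σ
∈-descentTops⁺ (u ∷ []) (() , _)
∈-descentTops⁺ (u ∷ v ∷ σ) (i , gt , eq) with v Fin.<? u | i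
... | yes _   | zero  = here eq
... | no  v≮u | zero  = contradiction gt v≮u
... | yes _   | suc i = there (∈-descentTops⁺ (v ∷ σ) (i , gt , eq))
... | no  _   | suc i = ∈-descentTops⁺ (v ∷ σ) (i , gt , eq)

∈-descentTops⁻ : ∀ {k m} (σ : Vec (Fin k) (suc m)) {t} → t ∈ descentTops σ → IsDescentTop σ t
∈-descentTops⁻ (u ∷ v ∷ σ) t∈ with v Fin.<? u
∈-descentTops⁻ (u ∷ v ∷ σ) (here eq)  | yes v<u = zero , v<u , eq
∈-descentTops⁻ (u ∷ v ∷ σ) (there t∈) | yes v<u with i , gt , eq ← ∈-descentTops⁻ (v ∷ σ) t∈ = suc i , gt , eq
∈-descentTops⁻ (u ∷ v ∷ σ) t∈         | no  _   with i , gt , eq ← ∈-descentTops⁻ (v ∷ σ) t∈ = suc i , gt , eq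

All-descentTops : ∀ {k m} {P : Fin k → Set} (σ : Vec (Fin k) (suc m)) →
                  VecAll.All P σ → All P (descentTops σ)
All-descentTops (u ∷ [])    _ = []
All-descentTops (u ∷ v ∷ σ) (pu ∷ pσ) with v Fin.<? u
... | yes _ = pu ∷ All-descentTops (v ∷ σ) pσ
... | no  _ = All-descentTops (v ∷ σ) pσ

descentTops-unique : ∀ {k m} (σ : Vec (Fin k) (suc m)) → Vec.Unique σ → Unique (descentTops σ)
descentTops-unique (u ∷ [])    _ = []
descentTops-unique (u ∷ v ∷ σ) (u∉ ∷ σ!) with v Fin.<? u
... | yes _ = All-descentTops (v ∷ σ) u∉ ∷ descentTops-unique (v ∷ σ) σ!
... | no  _ = descentTops-unique (v ∷ σ) σ!

module Monomials (R : CommutativeRing 0ℓ 0ℓ) (H : HalfPlane R)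
  (x : ℕ → CommutativeRing.Carrier R) where

  open CommutativeRing R hiding (zero)
  open HalfPlane H using (Upper; Upper-resp)
  open Stable R H using (NonNeg)
  open Eulerian R H x (λ _ → 1#) using (weight-sum≉0)
  open RawSemiringDefs (CommutativeSemiring.rawSemiring commutativeSemiring) using (product; _^_)
  open MonoidMult *-monoid using (×-congʳ)
  open Fold *-commutativeMonoid renaming (fold to Π; fold-↭ to Π-↭) using ()
  open Words commutativeSemiring x (λ _ → 1#) using (weight; weight-sum; step; step-desc; Σ; Σ-cong; Σ-map; Σ-↭)

  weight-descentTops : ∀ {k m} (σ : Vec (Fin k) (suc m)) →
                       weight (letters σ) ≈ Π (x ∘ toℕ) (descentTops σ)
  weight-descentTops (u ∷ []) = refl
  weight-descentTops (u ∷ v ∷ σ) with v Fin.<? u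
  ... | yes v<u = *-cong (reflexive (step-desc v<u)) (weight-descentTops (v ∷ σ))
  ... | no  v≮u = trans (*-congʳ (reflexive step-1)) (trans (*-identityˡ _) (weight-descentTops (v ∷ σ)))
    where
    step-1 : step (toℕ u) (toℕ v) ≡ 1#
    step-1 with toℕ v ℕ.<ᵇ toℕ u in eq
    ... | false = ≡.refl
    ... | true  = contradiction (ℕ.<ᵇ⇒< _ _ (≡.subst Bool.T (≡.sym eq) _)) v≮u

  product-cong : ∀ {m} {f g : Vector Carrier m} → (∀ i → f i ≈ g i) → product f ≈ product g
  product-cong {zero}  f≈g = refl
  product-cong {suc m} f≈g = *-cong (f≈g zero) (product-cong (f≈g ∘ suc))

  product-filter : ∀ {A : Set} {P : A → Set} (P? : Decidable P) (g : A → Carrier) {m} (f : Fin m → A) →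
    product (λ i → g (f i) ^ (if does (P? (f i)) then 1 else 0)) ≈ Π g (filter P? (List.tabulate f))
  product-filter P? g {zero}  f = refl
  product-filter P? g {suc m} f with P? (f zero)
  ... | yes _ = *-cong (*-identityʳ _) (product-filter P? g (f ∘ suc))
  ... | no  _ = trans (*-identityˡ _) (product-filter P? g (f ∘ suc))

  -- The monomial records the set of descent tops, while the weight has one factor for each descent.
  -- They agree because a letter of a word without repetitions is the top of at most one descent.
  descentTopMonomial-weight : ∀ {n} (σ : Vec (Fin (suc n)) (suc n)) → Vec.Unique σ →
    product (λ i → x (suc (toℕ i)) ^ lookup (descentTopMonomial σ) i) ≈ weight (letters σ)
  descentTopMonomial-weight {n} σ σ! = trans
    (product-cong λ i → reflexive (≡.cong (x (suc (toℕ i)) ^_)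
      (Vec.lookup∘tabulate (λ i → if does (descentTop? σ (suc i)) then 1 else 0) i)))
    (trans (product-filter (descentTop? σ) (x ∘ toℕ) suc)
    (trans (Π-↭ (x ∘ toℕ) tops↭)
    (sym (weight-descentTops σ))))
    where
    tops↭ : filter (descentTop? σ) (List.tabulate suc) ↭ descentTops σ
    tops↭ = unique∧⊆∧⊇⇒↭
      (Unique.filter⁺ (descentTop? σ) (Unique.tabulate⁺ Fin.suc-injective))
      (descentTops-unique σ σ!)
      (λ t∈ → ∈-descentTops⁺ σ (proj₂ (∈.∈-filter⁻ (descentTop? σ) {xs = List.tabulate suc} t∈)))
      (λ t∈ → from (∈-descentTops⁻ σ t∈))
      where
      from : ∀ {t} → DescentTop σ t → t ∈ filter (descentTop? σ) (List.tabulate suc)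
      -- The smallest letter has no variable and must be ruled out as a top.
      from {zero}  top = contradiction top (¬descentTop-zero σ)
      from {suc i} top = ∈.∈-filter⁺ (descentTop? σ) (∈.∈-tabulate⁺ i) top

  permutation-term : ∀ {n} → Vector Carrier n → Vec (Fin (suc n)) (suc n) → Carrier
  permutation-term w σ = 1# * product (λ i → w i ^ lookup (descentTopMonomial σ) i)

  permutation-sum : ∀ {n} → Vector Carrier n → Carrier
  permutation-sum {n} w = Σ (permutation-term w) (𝔖 (suc n))

  permutation-sum≈weight-sum : ∀ {n} (w : Vector Carrier n) → (∀ i → w i ≈ x (suc (toℕ i))) →
                               permutation-sum w ≈ weight-sum (suc n)
  permutation-sum≈weight-sum {n} w w≈x = begin
    permutation-sum w
      ≈⟨ Σ-cong {g = weight ∘ letters} (All.tabulate λ {σ} σ∈ → trans (*-identityˡ _)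
           (trans (product-cong λ i → ×-congʳ (lookup (descentTopMonomial σ) i) (w≈x i))
             (descentTopMonomial-weight σ (∈-𝔖⁻ σ∈)))) ⟩
    Σ (weight ∘ letters) (𝔖 (suc n))
      ≡⟨ Σ-map weight letters (𝔖 (suc n)) ⟨
    Σ weight (map letters (𝔖 (suc n)))
      ≈⟨ Σ-↭ weight (letters-𝔖-↭-perms (suc n)) ⟩
    weight-sum (suc n) ∎
    where open SetoidReasoning setoid

  permutation-sum≉0 : ∀ c → Upper c → (∀ j → NonNeg (c * x j)) →
                      ∀ {n} (w : Vector Carrier n) → (∀ i → w i ≈ x (suc (toℕ i))) →
                      ¬ permutation-sum w ≈ 0#
  permutation-sum≉0 c c>0 cx≥0 {n} w w≈x sum≈0 =
    weight-sum≉0 c cx≥0 (λ _ → Upper-resp (sym (*-identityʳ c)) c>0) n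
      (trans (sym (permutation-sum≈weight-sum w w≈x)) sum≈0)

-- Evaluation at complex points and the conclusion

private module C = CommutativeRing ℂ-commutativeRing
open Sums C.commutativeSemiring using (Σ)

eval-map : ∀ {A : Set} {n} (f : A → ℝ × Vec ℕ n) w (g : A → ℂ) → (∀ b → evalTerm (f b) w ≃ℂ g b) →
           ∀ as → eval (map f as) w ≃ℂ Σ g as
eval-map f w g f≃g []       = ≃-refl 0ℝ , ≃-refl 0ℝ
eval-map f w g f≃g (b ∷ as) =
  +ℂ-cong {evalTerm (f b) w} {g b} {eval (map f as) w} {Σ g as} (f≃g b) (eval-map f w g f≃g as)

-- The values at 0 and beyond n are junk: the smallest letter is never a descent top.
extend : ∀ {n} → Vector ℝ n → ℕ → ℝ
extend {zero}  a j             = 0ℝ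
extend {suc n} a zero          = 0ℝ
extend {suc n} a (suc zero)    = a zero
extend {suc n} a (suc (suc j)) = extend (a ∘ suc) (suc j)

extend-toℕ : ∀ {n} (a : Vector ℝ n) i → extend a (suc (toℕ i)) ≡ a i
extend-toℕ a zero    = ≡.refl
extend-toℕ a (suc i) = extend-toℕ (a ∘ suc) i

module _ {n : ℕ} (a : Vector ℝ n) (z : ℂ) where

  x : ℕ → ℂ
  x j = z *ℂ ofReal (extend a j)

  open Monomials ℂ-commutativeRing ℂ-halfPlane x
    using (permutation-term; permutation-sum; permutation-sum≉0)

  evalTerm≃permutation-term : ∀ (w : Vector ℂ n) σ → evalTerm (1ℝ , descentTopMonomial σ) w ≃ℂ permutation-term w σ
  evalTerm≃permutation-term w σ = ≃ℂ-pointwise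
    (evalTerm (1ℝ , descentTopMonomial σ) w) (permutation-term w σ) (λ _ → ≡.refl) (λ _ → ≡.refl)

  eval-A≃permutation-sum : ∀ (w : Vector ℂ n) → eval (A[𝐱,𝟏] n) w ≃ℂ permutation-sum w
  eval-A≃permutation-sum w =
    ≡.subst (λ p → eval p w ≃ℂ permutation-sum w) (≡.sym (A[𝐱,𝟏]-expand n))
      (eval-map (λ σ → 1ℝ , descentTopMonomial σ) w (permutation-term w)
        (evalTerm≃permutation-term w) (𝔖 (suc n)))

  -- As `c` times `z` times any real is real, all descent variables sit on the boundary of the
  -- closed half plane, whatever the signs of the entries of `a`. The ascent variables are 1, and
  -- `c` itself lies in the open half plane.
  eval-A≉0 : ∀ c → Pos (Im c) → (∀ r → Im (c *ℂ (z *ℂ ofReal r)) ≃ 0ℝ) →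
             ∀ w → (∀ i → w i ≃ℂ z *ℂ ofReal (a i)) →
             ¬ eval (A[𝐱,𝟏] n) w ≃ℂ ofReal 0ℝ
  eval-A≉0 c c>0 cz-real w w≃za eval≈0 = permutation-sum≉0 c c>0
    (λ j → ¬Pos-≤0 0ℝ (λ _ → ℚ.≤-refl) ∘ Pos-resp (-ℝ Im (c *ℂ x j)) 0ℝ
      (-ℝ-cong (Im (c *ℂ x j)) 0ℝ (cz-real (extend a j))))
    w
    (λ i → ≡.subst (λ r → w i ≃ℂ z *ℂ ofReal r) (≡.sym (extend-toℕ a i)) (w≃za i))
    (C.trans {permutation-sum w} {eval (A[𝐱,𝟏] n) w} {ofReal 0ℝ}
      (C.sym {eval (A[𝐱,𝟏] n) w} {permutation-sum w} (eval-A≃permutation-sum w)) eval≈0)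

corollary6p9 : (n : ℕ) → n ≥ 1 → IsRealZero (A[𝐱,𝟏] n)
corollary6p9 n _ a z eval≈0 = Re z , ≃-refl (Re z) , ≃0-tight (Im z)
  (λ z>0 → eval-A≉0 a z (-ℂ conjℂ z)
    (Pos-resp (Im z) (-ℝ (-ℝ Im z))
      (≃-pointwise (Im z) (-ℝ (-ℝ Im z)) (λ k → solve 1 (λ q → q := :- :- q) ≡.refl (seq (Im z) k))) z>0)
    -- Here `c` times `z` is minus the squared modulus of `z`, hence real.
    (λ r → ≃-pointwise (Im ((-ℂ conjℂ z) *ℂ (z *ℂ ofReal r))) 0ℝ λ k →
      solve 3 (λ p q r → (:- p) :* (p :* con ℚ.0ℚ :+ q :* r) :+
                         (:- :- q) :* (p :* r :+ :- (q :* con ℚ.0ℚ)) := con ℚ.0ℚ) ≡.refl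
        (seq (Re z) k) (seq (Im z) k) (seq r k))
    (λ i → z ℂ-ring.* ofReal (a i)) za≃ eval≈0)
  -- The imaginary part of `conjℂ z` unfolds to `-ℝ Im z`, so `z<0` is already the required
  -- positivity.
  (λ z<0 → eval-A≉0 a z (conjℂ z) z<0
    (λ r → ≃-pointwise (Im (conjℂ z *ℂ (z *ℂ ofReal r))) 0ℝ λ k →
      solve 3 (λ p q r → p :* (p :* con ℚ.0ℚ :+ q :* r) :+
                         (:- q) :* (p :* r :+ :- (q :* con ℚ.0ℚ)) := con ℚ.0ℚ) ≡.refl
        (seq (Re z) k) (seq (Im z) k) (seq r k))
    (λ i → z ℂ-ring.* ofReal (a i)) za≃ eval≈0)
  where
  open +-*-Solver using (solve; _:=_; _:+_; _:*_; :-_; con)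
  -- The product is spelled exactly as in IsRealZero: any other spelling makes the conversion
  -- checker compare the Cauchy proofs inside eval, which it does not finish in reasonable time.
  za≃ : ∀ i → z ℂ-ring.* ofReal (a i) ≃ℂ z *ℂ ofReal (a i)
  za≃ i = ≃ℂ-pointwise (z *ℂ ofReal (a i)) (z *ℂ ofReal (a i)) (λ _ → ≡.refl) (λ _ → ≡.refl)
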